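{- Let $\alpha$ be a cascading $n$-sequence, let $I=(a,a+1,\ldots,m)$ be one of its lower subintervals, let $\alpha_I$ be the cascading sequence consisting of the lower subintervals of $\alpha$ preceding $I$, and let $R_I=R(\alpha_I)=(\mu_1,\ldots,\mu_n)$. Let $r_a$ be the top row of $\mu_a$ and, for $i=a+1,\ldots,m$, let $r_i$ be the uppermost row of $\mu_i$ with $|r_i|\le|r_{i-1}|$. Then: (1) all riggings of $\mu_1,\ldots,\mu_{m-1}$ are zero, and $\overline{\mu_{l+1}}\subseteq\mu_l\subseteq\mu_{l+1}$ for every $l\in[m-1]$; (2) all rows of $\mu_m$ above $r_m$ have the same rigging as $r_m$, and this rigging is nonpositive and is the minimum of all riggings of $\mu_m$; (3) $f_m f_{m-1}\cdots f_{a+1}f_a(R_I)=(\mu'_1,\ldots,\mu'_n)$ where: $\mu'_j=\mu_j$ (with the same riggings) for $j\notin[a,m+1]$; for $j\in[a,m]$ the shape of $\mu'_j$ is obtained from $\mu_j$ by appending one box to row $r_j$; $\mu'_j$ has all riggings zero for $j\in[a,m-1]$; in $\mu'_m$ the row obtained from $r_m$ has rigging (rigging of $r_m$)$-1$, every row of $\mu_m$ of length strictly greater than $|r_m|$ has its rigging decreased by $1$, and all other rows keep their riggings; and, if $m<n$, $\mu'_{m+1}$ has the same shape as $\mu_{m+1}$, each of its rows of length strictly greater than $|r_m|$ has rigging increased by $1$, and its other rows keep their riggings.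
   Context: Type $A_n$, $[n]=\{1,\ldots,n\}$. Cartan matrix $A_{ab}=2$ if $a=b$, $-1$ if $|a-b|=1$, $0$ otherwise. A rigged configuration is a tuple of rigged partitions $(\nu_1,\ldots,\nu_n)$; a rigged partition is a finite multiset of strings $(i,x)$, $i\in\mathbb{Z}_{>0}$ length, $x\in\mathbb{Z}$ label, drawn as a Young diagram (English notation) whose rows are the strings sorted by decreasing length, each row carrying its label as its rigging. With $m^{(b)}_j$ the number of strings of length $j$ in $\nu_b$, the vacancy number is $p^{(a)}_i=-\sum_{b,j}A_{ab}\min(i,j)m^{(b)}_j$; the colabel of a string $(i,x)$ of $\nu_a$ is $p^{(a)}_i-x$. Operator $f_a$: if $\nu_a$ is empty add the string $(1,-1)$; otherwise let $x$ be the smallest label in $\nu_a$; if $x>0$ add $(1,-1)$; otherwise let $l$ be the greatest length of strings of $\nu_a$ with label $x$ and replace one $(l,x)$ by $(l+1,x-1)$; in all cases other strings keep their lengths and get new labels so that their colabels (with new vacancy numbers) are unchanged. For a finite integer sequence $\gamma=(\gamma_1,\ldots,\gamma_N)$ with entries in $[n]$, $R(\gamma)=f_{\gamma_N}\cdots f_{\gamma_1}(\emptyset,\ldots,\emptyset)$. Convention: a rigged partition with $k$ rows is regarded as having an extra row $k+1$ of length $0$ and rigging $0$ below its last row (so "uppermost row with $|r|\le c$" always exists; appending a box to this row creates a new row of length $1$). For a partition $\lambda$, $\overline{\lambda}$ is $\lambda$ with its top row deleted; $\subseteq$ is containment of Young diagrams. An $m$-lower subinterval is a tuple $(a,a+1,\ldots,m)$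 with $1\le a\le m\le n$; an $m$-component is a finite (possibly empty) sequence of $m$-lower subintervals ordered by nonincreasing length; a cascading $n$-sequence is the concatenation of an $n$-component, an $(n-1)$-component, $\ldots$, a $1$-component, regarded as a sequence of lower subintervals and also as the integer sequence obtained by concatenating them. -}

module Defs where

open import Data.Bool using (Bool; true; false; if_then_else_; _∧_; not)
open import Data.Nat as ℕ using (ℕ; zero; suc; _⊔_; _⊓_; _∸_; _≡ᵇ_)
open import Data.Integer as ℤ using (ℤ; +_; -_; _≤ᵇ_)
open import Data.Product using (_×_; _,_; proj₁; proj₂)
open import Data.Maybe using (Maybe; just; nothing)
open import Data.List using (List; []; _∷_; _++_; map; foldl; foldr; concatMap; applyUpTo; length; drop)
open import Data.List.Relation.Unary.All using (All)
open import Relation.Nullary.Decidable using (⌊_⌋)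
open import Relation.Binary.PropositionalEquality using (_≡_)

String : Set
String = ℕ × ℤ

-- A rigged partition: a finite multiset of strings, represented by a list
-- (order irrelevant; multiset equality is list permutation _↭_).
RiggedPartition : Set
RiggedPartition = List String

-- A rigged configuration: colours 1..n are meaningful (colour b ↦ ν_b).
Config : Set
Config = ℕ → RiggedPartition

emptyConfig : Config
emptyConfig _ = []

len : String → ℕ
len = proj₁

rig : String → ℤ
rig = proj₂

cartan : ℕ → ℕ → ℤ
cartan a b =
  if a ≡ᵇ b then + 2
  else if (suc a ≡ᵇ b) Data.Bool.∨ (suc b ≡ᵇ a) then ℤ.-[1+ 0 ] else + 0

sumℤ : List ℤ → ℤ
sumℤ = foldr ℤ._+_ (+ 0)

-- Σ_j min(i,j) m^{(b)}_j  =  Σ over strings s of ν_b of min(i, |s|)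
minSum : ℕ → RiggedPartition → ℤ
minSum i ν = sumℤ (map (λ s → + (i ⊓ len s)) ν)

vac : ℕ → Config → ℕ → ℕ → ℤ
vac n C a i = - sumℤ (map (λ b → cartan a b ℤ.* minSum i (C b)) (applyUpTo suc n))

minLabel : RiggedPartition → Maybe ℤ
minLabel [] = nothing
minLabel (s ∷ ν) with minLabel ν
... | nothing = just (rig s)
... | just y  = just (rig s ℤ.⊓ y)

_==ℤ_ : ℤ → ℤ → Bool
x ==ℤ y = ⌊ x ℤ.≟ y ⌋

-- greatest length of a string with label x (0 if none)
maxLenWithLabel : ℤ → RiggedPartition → ℕ
maxLenWithLabel x [] = 0
maxLenWithLabel x (s ∷ ν) =
  if rig s ==ℤ x then len s ⊔ maxLenWithLabel x ν else maxLenWithLabel x ν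

removeOne : String → RiggedPartition → RiggedPartition
removeOne t [] = []
removeOne t (s ∷ ν) =
  if (len s ≡ᵇ len t) ∧ (rig s ==ℤ rig t) then ν else s ∷ removeOne t ν

-- (new string , remaining strings of ν_a whose labels still need adjusting)
fStep : RiggedPartition → String × RiggedPartition
fStep ν with minLabel ν
... | nothing = (1 , ℤ.-[1+ 0 ]) , ν
... | just x  =
  if + 1 ≤ᵇ x then ((1 , ℤ.-[1+ 0 ]) , ν)
  else ((suc (maxLenWithLabel x ν) , x ℤ.- + 1)
       , removeOne (maxLenWithLabel x ν , x) ν)

-- f_a on rigged configurations of type A_n: strings other than the new one
-- keep their lengths and get new labels preserving their colabels.
f : ℕ → ℕ → Config → Config
f n a C b =
  if b ≡ᵇ a then proj₁ st ∷ map (adjust b) (proj₂ st)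
  else map (adjust b) (C b)
  where
  st = fStep (C a)
  C' : Config
  C' c = if c ≡ᵇ a then proj₁ st ∷ proj₂ st else C c
  adjust : ℕ → String → String
  adjust c s = len s , (rig s ℤ.+ (vac n C' c (len s) ℤ.- vac n C c (len s)))

applyFs : ℕ → List ℕ → Config → Config
applyFs n γ C = foldl (λ D c → f n c D) C γ

R : ℕ → List ℕ → Config
R n γ = applyFs n γ emptyConfig

-- a lower subinterval (a, a+1, …, m) is recorded as the pair (a , m)
Interval : Set
Interval = ℕ × ℕ

intervalSeq : Interval → List ℕ
intervalSeq (a , m) = applyUpTo (a ℕ.+_) (suc m ∸ a)

intervalLength : Interval → ℕ
intervalLength (a , m) = suc m ∸ a

-- m-lower subinterval: 1 ≤ a ≤ m  (m ≤ n enforced by the cascade)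
IsLower : ℕ → Interval → Set
IsLower m (a , m') = (m' ≡ m) × (1 ℕ.≤ a) × (a ℕ.≤ m)

data NonincLen : List Interval → Set where
  []  : NonincLen []
  [-] : ∀ {I} → NonincLen (I ∷ [])
  _∷_ : ∀ {I J Is} → intervalLength J ℕ.≤ intervalLength I →
        NonincLen (J ∷ Is) → NonincLen (I ∷ J ∷ Is)

IsComponent : ℕ → List Interval → Set
IsComponent m c = All (IsLower m) c × NonincLen c

IsCascading : ℕ → List Interval → Set
IsCascading zero α = α ≡ []
IsCascading (suc k) α =
  Data.Product.Σ (List Interval) λ c → Data.Product.Σ (List Interval) λ β →
    IsComponent (suc k) c × IsCascading k β × (α ≡ c ++ β)

toSeq : List Interval → List ℕ
toSeq = concatMap intervalSeq

-- insertion of a row: rows sorted by decreasing length; rows of equal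
-- length ordered by increasing rigging
before : String → String → Bool
before s t = not (len s ℕ.≤ᵇ len t) Data.Bool.∨ ((len s ≡ᵇ len t) ∧ (rig s ≤ᵇ rig t))

insertRow : String → List String → List String
insertRow s [] = s ∷ []
insertRow s (t ∷ ts) = if before s t then s ∷ t ∷ ts else t ∷ insertRow s ts

-- the rows of the diagram, top to bottom (the extra length-0 row with
-- rigging 0 sits at index = length of this list)
rows : RiggedPartition → List String
rows = foldr insertRow []

rowAt : List String → ℕ → String
rowAt []       _       = 0 , + 0
rowAt (s ∷ ss) zero    = s
rowAt (s ∷ ss) (suc k) = rowAt ss k

-- index of the uppermost row of length ≤ c (the extra row if none)
idxLE : ℕ → List String → ℕ
idxLE c [] = 0
idxLE c (s ∷ ss) = if len s ℕ.≤ᵇ c then 0 else suc (idxLE c ss)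

-- apply g to row k (to the extra row (0,0) if k ≥ number of rows,
-- which then becomes a genuine new row)
adjustRow : ℕ → (String → String) → List String → List String
adjustRow k g [] = g (0 , + 0) ∷ []
adjustRow zero g (s ∷ ss) = g s ∷ ss
adjustRow (suc k) g (s ∷ ss) = s ∷ adjustRow k g ss

addBoxAt : ℕ → List String → List String
addBoxAt k = adjustRow k (λ s → suc (len s) , rig s)

shape : RiggedPartition → List ℕ
shape ν = map len (rows ν)

topDeleted : List ℕ → List ℕ
topDeleted = drop 1

lengthAt : List ℕ → ℕ → ℕ
lengthAt []       _       = 0
lengthAt (l ∷ ls) zero    = l
lengthAt (l ∷ ls) (suc k) = lengthAt ls k

_⊆ᴰ_ : List ℕ → List ℕ → Set
λ₁ ⊆ᴰ λ₂ = ∀ k → lengthAt λ₁ k ℕ.≤ lengthAt λ₂ k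

-- The rows r_a, r_{a+1}, … of the theorem, for a configuration μ.
-- rIdx μ a d = index (in rows μ_{a+d}) of r_{a+d};
-- rLen μ a d = |r_{a+d}|.

rIdx : Config → ℕ → ℕ → ℕ
rLen : Config → ℕ → ℕ → ℕ
rIdx μ a zero    = 0
rIdx μ a (suc d) = idxLE (rLen μ a d) (rows (μ (a ℕ.+ suc d)))
rLen μ a d = len (rowAt (rows (μ (a ℕ.+ d))) (rIdx μ a d))

rRow : Config → ℕ → ℕ → String
rRow μ a j = rowAt (rows (μ j)) (rIdx μ a (j ∸ a))

-- By induction along the cascading sequence we carry an invariant for the configuration
-- reached after an interval ending at colour k of length L: colours below k have zero
-- riggings and interlacing shapes, and (2) holds at colour k for every start a with
-- k - a + 1 ≤ L.  Parts (1) and (2) are this invariant (nonincreasing lengths within a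
-- component, and lower colours in later components, keep it applicable), and (3) is an
-- explicit computation of f_m ⋯ f_a.  When f_{a+d} acts, f_{a+d-1} has just raised by one the
-- riggings of the rows of μ_{a+d} longer than |r_{a+d-1}|; the rows above r_{a+d} thus have
-- rigging one more than r_{a+d}, which is minimal, so f_{a+d} adds its box to r_{a+d}.  It
-- lowers the other rows longer than |r_{a+d}| by two and raises those in the neighbouring
-- colours by one, which brings colour a+d-1 back to all-zero riggings.  The rows r_a, …, r_m
-- move weakly down and get shorter, so the new shapes still interlace and the new top rows
-- of colour m all carry the minimal rigging, re-establishing the invariant for k = m and
-- L = m - a + 1.

module Submission where

open import Defs
open import Data.Bool using (Bool; true; false; if_then_else_)
open import Data.Integer as ℤ using (ℤ; +_; -[1+_])
import Data.Integer.Properties as ℤP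
open import Data.Integer.Tactic.RingSolver using (solve-∀)
open import Algebra.Properties.CommutativeSemigroup ℤP.+-commutativeSemigroup using (x∙yz≈y∙xz; xy∙z≈xz∙y)
open import Data.List using (List; []; _∷_; _++_; map; length; take; drop; applyUpTo)
import Data.List.Properties as LP
open import Data.List.Membership.Propositional using (_∈_)
open import Data.List.Relation.Binary.Permutation.Propositional
  using (_↭_; ↭-refl; ↭-sym; ↭-trans; ↭-reflexive; prep; swap; module PermutationReasoning)
open import Data.List.Relation.Binary.Permutation.Propositional.Properties
  using (All-resp-↭; Any-resp-↭; ∈-resp-↭; ↭-length; drop-∷; shift; map⁺)
open import Data.List.Relation.Unary.All as All using (All; []; _∷_)
import Data.List.Relation.Unary.All.Properties as AllP
open import Data.List.Relation.Unary.AllPairs as AllPairs using (AllPairs; []; _∷_)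
import Data.List.Relation.Unary.AllPairs.Properties as AllPairsP
open import Data.List.Relation.Unary.Any using (Any; here; there)
open import Data.List.Relation.Unary.Any.Properties using (++⁺ʳ)
open import Data.Maybe using (just; nothing)
open import Data.Nat as ℕ using (ℕ; zero; suc; _∸_; _<ᵇ_; _≡ᵇ_; z≤n; s≤s)
import Data.Nat.Properties as ℕP
open import Data.Product using (_×_; _,_; proj₁; proj₂; ∃-syntax; uncurry)
open import Data.Sum using (_⊎_; inj₁; inj₂; map₂)
open import Data.Unit using (⊤; tt)
open import Function using (_∘_)
open import Relation.Binary.Definitions using (Antisymmetric)
open import Relation.Binary.PropositionalEquality
open import Relation.Nullary using (¬_; contradiction)
open import Relation.Nullary.Decidable using (yes; no)
open import Relation.Nullary.Reflects using (Reflects; ofʸ; ofⁿ; det; fromEquivalence)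

module _ {P : Set} {b : Bool} (r : Reflects P b) where

  reflects-true : P → b ≡ true
  reflects-true p = det r (ofʸ p)

  reflects-false : ¬ P → b ≡ false
  reflects-false ¬p = det r (ofⁿ ¬p)

if-true : ∀ {A : Set} {b} {x y : A} → b ≡ true → (if b then x else y) ≡ x
if-true refl = refl

if-false : ∀ {A : Set} {b} {x y : A} → b ≡ false → (if b then x else y) ≡ y
if-false refl = refl

≡ᵇ-reflects-≡ : ∀ m n → Reflects (m ≡ n) (m ≡ᵇ n)
≡ᵇ-reflects-≡ m n = fromEquivalence (ℕP.≡ᵇ⇒≡ m n) (ℕP.≡⇒≡ᵇ m n)

ℤ≤ᵇ-reflects-≤ : ∀ i j → Reflects (i ℤ.≤ j) (i ℤ.≤ᵇ j)
ℤ≤ᵇ-reflects-≤ i j = fromEquivalence ℤP.≤ᵇ⇒≤ ℤP.≤⇒≤ᵇ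

-- Sorting the rows of a rigged partition

_≼_ : String → String → Set
s ≼ t = len t ℕ.< len s ⊎ (len s ≡ len t × rig s ℤ.≤ rig t)

Sorted : List String → Set
Sorted = AllPairs _≼_

≼-trans : ∀ {s t u} → s ≼ t → t ≼ u → s ≼ u
≼-trans (inj₁ t<s) (inj₁ u<t) = inj₁ (ℕP.<-trans u<t t<s)
≼-trans (inj₁ t<s) (inj₂ (refl , _)) = inj₁ t<s
≼-trans (inj₂ (refl , _)) (inj₁ u<t) = inj₁ u<t
≼-trans (inj₂ (refl , s≤t)) (inj₂ (refl , t≤u)) = inj₂ (refl , ℤP.≤-trans s≤t t≤u)

≼-antisym : Antisymmetric _≡_ _≼_
≼-antisym (inj₁ t<s) (inj₁ s<t) = contradiction t<s (ℕP.<-asym s<t)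
≼-antisym (inj₁ t<s) (inj₂ (t≡s , _)) = contradiction t<s (ℕP.<-irrefl t≡s)
≼-antisym (inj₂ (s≡t , _)) (inj₁ s<t) = contradiction s<t (ℕP.<-irrefl s≡t)
≼-antisym {_ , x} {_ , y} (inj₂ (refl , x≤y)) (inj₂ (_ , y≤x)) = cong (_ ,_) (ℤP.≤-antisym x≤y y≤x)

≼-by-length : ∀ {s t} → len t ℕ.≤ len s → rig s ℤ.≤ rig t → s ≼ t
≼-by-length t≤s x≤y with ℕP.m≤n⇒m<n∨m≡n t≤s
... | inj₁ t<s = inj₁ t<s
... | inj₂ t≡s = inj₂ (sym t≡s , x≤y)

≼⇒len-≥ : ∀ {s t} → s ≼ t → len t ℕ.≤ len s
≼⇒len-≥ (inj₁ t<s) = ℕP.<⇒≤ t<s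
≼⇒len-≥ (inj₂ (s≡t , _)) = ℕP.≤-reflexive (sym s≡t)

before-correct : ∀ s t → if before s t then s ≼ t else t ≼ s
before-correct s t with len s ℕ.≤ᵇ len t | ℕP.≤ᵇ-reflects-≤ (len s) (len t)
... | false | ofⁿ s≰t = inj₁ (ℕP.≰⇒> s≰t)
... | true  | ofʸ s≤t with len s ≡ᵇ len t | ≡ᵇ-reflects-≡ (len s) (len t)
...   | false | ofⁿ s≢t = inj₁ (ℕP.≤∧≢⇒< s≤t s≢t)
...   | true  | ofʸ s≡t with rig s ℤ.≤ᵇ rig t | ℤ≤ᵇ-reflects-≤ (rig s) (rig t)
...     | true  | ofʸ x≤y = inj₂ (s≡t , x≤y)
...     | false | ofⁿ x≰y = inj₂ (sym s≡t , ℤP.<⇒≤ (ℤP.≰⇒> x≰y))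

insertRow-↭ : ∀ s ts → insertRow s ts ↭ s ∷ ts
insertRow-↭ s [] = ↭-refl
insertRow-↭ s (t ∷ ts) with before s t
... | true  = ↭-refl
... | false = ↭-trans (prep t (insertRow-↭ s ts)) (swap t s ↭-refl)

insertRow-sorted : ∀ s {ts} → Sorted ts → Sorted (insertRow s ts)
insertRow-sorted s [] = [] ∷ []
insertRow-sorted s {t ∷ ts} (t≼ts ∷ ts↗) with before s t | before-correct s t
... | true  | s≼t = (s≼t ∷ All.map (≼-trans s≼t) t≼ts) ∷ t≼ts ∷ ts↗
... | false | t≼s = All-resp-↭ (↭-sym (insertRow-↭ s ts)) (t≼s ∷ t≼ts) ∷ insertRow-sorted s ts↗

rows-↭ : ∀ ν → rows ν ↭ ν
rows-↭ [] = ↭-refl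
rows-↭ (s ∷ ν) = ↭-trans (insertRow-↭ s (rows ν)) (prep s (rows-↭ ν))

rows-sorted : ∀ ν → Sorted (rows ν)
rows-sorted [] = []
rows-sorted (s ∷ ν) = insertRow-sorted s (rows-sorted ν)

module _ {A : Set} {R : A → A → Set} (antisym : Antisymmetric _≡_ R) where

  private
    heads-≡ : ∀ {x y xs ys} → All (R x) xs → All (R y) ys → x ∈ y ∷ ys → y ∈ x ∷ xs → x ≡ y
    heads-≡ _ _ (here x≡y) _ = x≡y
    heads-≡ _ _ (there _) (here y≡x) = sym y≡x
    heads-≡ x≤xs y≤ys (there x∈ys) (there y∈xs) = antisym (All.lookup x≤xs y∈xs) (All.lookup y≤ys x∈ys)

  AllPairs-↭⇒≡ : ∀ {xs ys} → AllPairs R xs → AllPairs R ys → xs ↭ ys → xs ≡ ys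
  AllPairs-↭⇒≡ {[]} {[]} _ _ _ = refl
  AllPairs-↭⇒≡ {[]} {_ ∷ _} _ _ p with ↭-length p
  ... | ()
  AllPairs-↭⇒≡ {_ ∷ _} {[]} _ _ p with ↭-length p
  ... | ()
  AllPairs-↭⇒≡ {x ∷ xs} {y ∷ ys} (x≤xs ∷ xs↗) (y≤ys ∷ ys↗) p
    with heads-≡ x≤xs y≤ys (∈-resp-↭ p (here refl)) (∈-resp-↭ (↭-sym p) (here refl))
  ... | refl = cong (x ∷_) (AllPairs-↭⇒≡ xs↗ ys↗ (drop-∷ p))

rows-of-sorted : ∀ {ν xs} → ν ↭ xs → Sorted xs → rows ν ≡ xs
rows-of-sorted {ν} ν↭xs xs↗ = AllPairs-↭⇒≡ ≼-antisym (rows-sorted ν) xs↗ (↭-trans (rows-↭ ν) ν↭xs)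

rows-cong : ∀ {ν ν'} → ν ↭ ν' → rows ν ≡ rows ν'
rows-cong {ν} {ν'} ν↭ν' = rows-of-sorted (↭-trans ν↭ν' (↭-sym (rows-↭ ν'))) (rows-sorted ν')

sorted-++-∷ : ∀ {ss x ts} → Sorted ss → All (_≼ x) ss → All (x ≼_) ts → Sorted ts → Sorted (ss ++ x ∷ ts)
sorted-++-∷ ss↗ ss≼x x≼ts ts↗ =
  AllPairsP.++⁺ ss↗ (x≼ts ∷ ts↗) (All.map (λ s≼x → s≼x ∷ All.map (≼-trans s≼x) x≼ts) ss≼x)

lenAt : List String → ℕ → ℕ
lenAt ss k = len (rowAt ss k)

lengthAt-map-len : ∀ ss k → lengthAt (map len ss) k ≡ lenAt ss k
lengthAt-map-len [] k = refl
lengthAt-map-len (s ∷ ss) zero = refl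
lengthAt-map-len (s ∷ ss) (suc k) = lengthAt-map-len ss k

rowAt-All : ∀ {P : String → Set} {ss} → All P ss → P (0 , + 0) → ∀ k → P (rowAt ss k)
rowAt-All [] p0 k = p0
rowAt-All (p ∷ ps) p0 zero = p
rowAt-All (p ∷ ps) p0 (suc k) = rowAt-All ps p0 k

lenAt-antitone : ∀ {ss} → Sorted ss → ∀ {k k'} → k ℕ.≤ k' → lenAt ss k' ℕ.≤ lenAt ss k
lenAt-antitone [] _ = z≤n
lenAt-antitone (_ ∷ _) {zero} {zero} _ = ℕP.≤-refl
lenAt-antitone (s≼ss ∷ _) {zero} {suc k'} _ = rowAt-All (All.map ≼⇒len-≥ s≼ss) z≤n k'
lenAt-antitone (_ ∷ ss↗) {suc k} {suc k'} (s≤s k≤k') = lenAt-antitone ss↗ k≤k'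

idxLE-≤-length : ∀ c ss → idxLE c ss ℕ.≤ length ss
idxLE-≤-length c [] = z≤n
idxLE-≤-length c (s ∷ ss) with len s ℕ.≤ᵇ c
... | true  = z≤n
... | false = s≤s (idxLE-≤-length c ss)

lenAt-idxLE : ∀ c ss → lenAt ss (idxLE c ss) ℕ.≤ c
lenAt-idxLE c [] = z≤n
lenAt-idxLE c (s ∷ ss) with len s ℕ.≤ᵇ c | ℕP.≤ᵇ-reflects-≤ (len s) c
... | true  | ofʸ s≤c = s≤c
... | false | _ = lenAt-idxLE c ss

lenAt-above-idxLE : ∀ c ss k → k ℕ.< idxLE c ss → c ℕ.< lenAt ss k
lenAt-above-idxLE c (s ∷ ss) k k<idx with len s ℕ.≤ᵇ c | ℕP.≤ᵇ-reflects-≤ (len s) c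
lenAt-above-idxLE c (s ∷ ss) zero _ | false | ofⁿ s≰c = ℕP.≰⇒> s≰c
lenAt-above-idxLE c (s ∷ ss) (suc k) (s≤s k<idx) | false | _ = lenAt-above-idxLE c ss k k<idx

idxLE-≤ : ∀ c ss k → lenAt ss k ℕ.≤ c → idxLE c ss ℕ.≤ k
idxLE-≤ c [] k _ = z≤n
idxLE-≤ c (s ∷ ss) k sₖ≤c with len s ℕ.≤ᵇ c | ℕP.≤ᵇ-reflects-≤ (len s) c
idxLE-≤ c (s ∷ ss) k _ | true | _ = z≤n
idxLE-≤ c (s ∷ ss) zero s≤c | false | ofⁿ s≰c = contradiction s≤c s≰c
idxLE-≤ c (s ∷ ss) (suc k) sₖ≤c | false | _ = s≤s (idxLE-≤ c ss k sₖ≤c)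

idxLE-≥ : ∀ c ss K → (∀ k → k ℕ.< K → c ℕ.< lenAt ss k) → K ℕ.≤ idxLE c ss
idxLE-≥ c ss K above with ℕP.≤-<-connex K (idxLE c ss)
... | inj₁ K≤idx = K≤idx
... | inj₂ idx<K = contradiction (lenAt-idxLE c ss) (ℕP.<⇒≱ (above (idxLE c ss) idx<K))

All-rowAt : ∀ {P : String → Set} {ss} → All P ss → ∀ k → k ℕ.< length ss → P (rowAt ss k)
All-rowAt (p ∷ _) zero _ = p
All-rowAt (_ ∷ ps) (suc k) (s≤s k<) = All-rowAt ps k k<

rowAt-beyond : ∀ ss k → length ss ℕ.≤ k → rowAt ss k ≡ (0 , + 0)
rowAt-beyond [] k _ = refl
rowAt-beyond (s ∷ ss) (suc k) (s≤s p) = rowAt-beyond ss k p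

rowAt-split : ∀ ss k → k ℕ.< length ss → ss ≡ take k ss ++ rowAt ss k ∷ drop (suc k) ss
rowAt-split (s ∷ ss) zero _ = refl
rowAt-split (s ∷ ss) (suc k) (s≤s k<) = cong (s ∷_) (rowAt-split ss k k<)

rowAt-map : ∀ {h : String → String} → h (0 , + 0) ≡ (0 , + 0) → ∀ ss k → rowAt (map h ss) k ≡ h (rowAt ss k)
rowAt-map h0 [] k = sym h0
rowAt-map h0 (s ∷ ss) zero = refl
rowAt-map h0 (s ∷ ss) (suc k) = rowAt-map h0 ss k

rowAt-++ˡ : ∀ (ss ts : List String) k → k ℕ.< length ss → rowAt (ss ++ ts) k ≡ rowAt ss k
rowAt-++ˡ (s ∷ ss) ts zero _ = refl
rowAt-++ˡ (s ∷ ss) ts (suc k) (s≤s k<) = rowAt-++ˡ ss ts k k<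

rowAt-++-length : ∀ (ss : List String) t ts → rowAt (ss ++ t ∷ ts) (length ss) ≡ t
rowAt-++-length [] t ts = refl
rowAt-++-length (s ∷ ss) t ts = rowAt-++-length ss t ts

length-take-≤ : ∀ {A : Set} k (xs : List A) → k ℕ.≤ length xs → length (take k xs) ≡ k
length-take-≤ k xs k≤ = trans (LP.length-take k xs) (ℕP.m≤n⇒m⊓n≡m k≤)

All-take-rowAt : ∀ {P : String → Set} k ss → (∀ j → j ℕ.< k → P (rowAt ss j)) → All P (take k ss)
All-take-rowAt zero ss _ = []
All-take-rowAt (suc k) [] _ = []
All-take-rowAt (suc k) (s ∷ ss) h = h 0 (s≤s z≤n) ∷ All-take-rowAt k ss (λ j j<k → h (suc j) (s≤s j<k))

All-drop-rowAt : ∀ {P : String → Set} k ss → (∀ j → k ℕ.≤ j → j ℕ.< length ss → P (rowAt ss j)) → All P (drop k ss)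
All-drop-rowAt zero [] _ = []
All-drop-rowAt zero (s ∷ ss) h = h 0 z≤n (s≤s z≤n) ∷ All-drop-rowAt zero ss (λ j _ j< → h (suc j) z≤n (s≤s j<))
All-drop-rowAt (suc k) [] _ = []
All-drop-rowAt (suc k) (s ∷ ss) h = All-drop-rowAt k ss (λ j k≤j j< → h (suc j) (s≤s k≤j) (s≤s j<))

len≤top : ∀ ν → All (λ s → len s ℕ.≤ lenAt (rows ν) 0) ν
len≤top ν = All-resp-↭ (rows-↭ ν) (All-drop-rowAt 0 (rows ν) (λ k _ _ → lenAt-antitone (rows-sorted ν) z≤n))

adjustRow-split : ∀ k g ss → k ℕ.≤ length ss → adjustRow k g ss ≡ take k ss ++ g (rowAt ss k) ∷ drop (suc k) ss
adjustRow-split zero g [] _ = refl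
adjustRow-split zero g (s ∷ ss) _ = refl
adjustRow-split (suc k) g (s ∷ ss) (s≤s k≤) = cong (s ∷_) (adjustRow-split k g ss k≤)

lenAt-adjustRow : ∀ k g ss j → k ℕ.≤ length ss →
  lenAt (adjustRow k g ss) j ≡ (if j ≡ᵇ k then len (g (rowAt ss k)) else lenAt ss j)
lenAt-adjustRow zero g [] zero _ = refl
lenAt-adjustRow zero g [] (suc j) _ = refl
lenAt-adjustRow zero g (s ∷ ss) zero _ = refl
lenAt-adjustRow zero g (s ∷ ss) (suc j) _ = refl
lenAt-adjustRow (suc k) g (s ∷ ss) zero _ = refl
lenAt-adjustRow (suc k) g (s ∷ ss) (suc j) (s≤s k≤) = lenAt-adjustRow k g ss j k≤

map-len-adjustRow : ∀ k {g g'} {ss ts} → (∀ s t → len s ≡ len t → len (g s) ≡ len (g' t)) →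
  map len ss ≡ map len ts → map len (adjustRow k g ss) ≡ map len (adjustRow k g' ts)
map-len-adjustRow k {ss = []} {[]} g≈g' _ = cong (_∷ []) (g≈g' _ _ refl)
map-len-adjustRow zero {ss = s ∷ ss} {t ∷ ts} g≈g' eq =
  cong₂ _∷_ (g≈g' s t (LP.∷-injectiveˡ eq)) (LP.∷-injectiveʳ eq)
map-len-adjustRow (suc k) {ss = s ∷ ss} {t ∷ ts} g≈g' eq =
  cong₂ _∷_ (LP.∷-injectiveˡ eq) (map-len-adjustRow k g≈g' (LP.∷-injectiveʳ eq))

-- The string on which f_a acts

minLabel-∷≢nothing : ∀ s ν → minLabel (s ∷ ν) ≢ nothing
minLabel-∷≢nothing s ν eq with minLabel ν
minLabel-∷≢nothing s ν () | nothing
minLabel-∷≢nothing s ν () | just _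

minLabel-sound : ∀ ν {y} → minLabel ν ≡ just y → Any (λ s → rig s ≡ y) ν × All (λ s → y ℤ.≤ rig s) ν
minLabel-sound (s ∷ ν) eq with minLabel ν in eqν
minLabel-sound (s ∷ []) refl | nothing = here refl , ℤP.≤-refl ∷ []
minLabel-sound (s ∷ t ∷ ν) refl | nothing = contradiction eqν (minLabel-∷≢nothing t ν)
minLabel-sound (s ∷ ν) refl | just z with minLabel-sound ν eqν | ℤP.≤-total (rig s) z
... | _ , z≤ν | inj₁ s≤z rewrite ℤP.i≤j⇒i⊓j≡i s≤z = here refl , ℤP.≤-refl ∷ All.map (ℤP.≤-trans s≤z) z≤ν
... | z∈ν , z≤ν | inj₂ z≤s rewrite ℤP.i≥j⇒i⊓j≡j z≤s = there z∈ν , z≤s ∷ z≤ν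

lower-bound≤attained : ∀ {u v ss} → Any (λ s → rig s ≡ u) ss → All (λ s → v ℤ.≤ rig s) ss → v ℤ.≤ u
lower-bound≤attained (here refl) (v≤ ∷ _) = v≤
lower-bound≤attained (there u∈ss) (_ ∷ v≤ss) = lower-bound≤attained u∈ss v≤ss

minLabel-attained : ∀ ν {x} → Any (λ s → rig s ≡ x) ν → All (λ s → x ℤ.≤ rig s) ν → minLabel ν ≡ just x
minLabel-attained (s ∷ ν) x∈ν x≤ν with minLabel (s ∷ ν) in eq
... | nothing = contradiction eq (minLabel-∷≢nothing s ν)
... | just y with minLabel-sound (s ∷ ν) eq
...   | y∈ν , y≤ν = cong just (ℤP.≤-antisym (lower-bound≤attained x∈ν y≤ν) (lower-bound≤attained y∈ν x≤ν))

==ℤ-reflects-≡ : ∀ x y → Reflects (x ≡ y) (x ==ℤ y)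
==ℤ-reflects-≡ x y with x ℤ.≟ y
... | yes x≡y = ofʸ x≡y
... | no x≢y = ofⁿ x≢y

maxLenWithLabel-≤ : ∀ x l ν → All (λ s → rig s ≡ x → len s ℕ.≤ l) ν → maxLenWithLabel x ν ℕ.≤ l
maxLenWithLabel-≤ x l [] _ = z≤n
maxLenWithLabel-≤ x l (s ∷ ν) (p ∷ ps) with rig s ==ℤ x | ==ℤ-reflects-≡ (rig s) x
... | true  | ofʸ s≡x = ℕP.⊔-lub (p s≡x) (maxLenWithLabel-≤ x l ν ps)
... | false | _ = maxLenWithLabel-≤ x l ν ps

≤-maxLenWithLabel : ∀ x l ν → (l , x) ∈ ν → l ℕ.≤ maxLenWithLabel x ν
≤-maxLenWithLabel x l (s ∷ ν) l,x∈ with rig s ==ℤ x | ==ℤ-reflects-≡ (rig s) x | l,x∈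
... | true  | _ | here refl = ℕP.m≤m⊔n l _
... | true  | _ | there l,x∈ν = ℕP.m≤n⇒m≤o⊔n (len s) (≤-maxLenWithLabel x l ν l,x∈ν)
... | false | ofⁿ s≢x | here refl = contradiction refl s≢x
... | false | _ | there l,x∈ν = ≤-maxLenWithLabel x l ν l,x∈ν

removeOne-↭ : ∀ t ν → t ∈ ν → ν ↭ t ∷ removeOne t ν
removeOne-↭ t (s ∷ ν) t∈
  with len s ≡ᵇ len t | ≡ᵇ-reflects-≡ (len s) (len t) | rig s ==ℤ rig t | ==ℤ-reflects-≡ (rig s) (rig t)
... | true  | ofʸ refl | true | ofʸ refl = ↭-refl
... | true  | _ | false | ofⁿ r≢ with t∈
...   | here refl = contradiction refl r≢
...   | there t∈ν = ↭-trans (prep s (removeOne-↭ t ν t∈ν)) (swap s t ↭-refl)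
removeOne-↭ t (s ∷ ν) t∈ | false | ofⁿ l≢ | _ | _ with t∈
...   | here refl = contradiction refl l≢
...   | there t∈ν = ↭-trans (prep s (removeOne-↭ t ν t∈ν)) (swap s t ↭-refl)

sumℤ-↭ : ∀ {xs ys} → xs ↭ ys → sumℤ xs ≡ sumℤ ys
sumℤ-↭ _↭_.refl = refl
sumℤ-↭ (prep x p) = cong (ℤ._+_ x) (sumℤ-↭ p)
sumℤ-↭ (swap x y p) = trans (cong (λ s → x ℤ.+ (y ℤ.+ s)) (sumℤ-↭ p)) (x∙yz≈y∙xz x y _)
sumℤ-↭ (_↭_.trans p q) = trans (sumℤ-↭ p) (sumℤ-↭ q)

minSum-↭ : ∀ i {ν ν'} → ν ↭ ν' → minSum i ν ≡ minSum i ν'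
minSum-↭ i p = sumℤ-↭ (map⁺ _ p)

fStep-nonpositive : ∀ N {c} → minLabel N ≡ just c → c ℤ.≤ + 0 →
  fStep N ≡ ((suc (maxLenWithLabel c N) , c ℤ.- + 1) , removeOne (maxLenWithLabel c N , c) N)
fStep-nonpositive N {c} eq c≤0
  rewrite eq | reflects-false (ℤ≤ᵇ-reflects-≤ (+ 1) c) (ℤP.<⇒≱ (ℤP.≤-<-trans c≤0 (ℤ.+<+ (s≤s z≤n)))) = refl

fStep-positive : ∀ N → All (λ s → + 1 ℤ.≤ rig s) N → fStep N ≡ ((1 , -[1+ 0 ]) , N)
fStep-positive N 1≤N with minLabel N in eq
... | nothing = refl
... | just y with minLabel-sound N eq
...   | y∈N , _ rewrite reflects-true (ℤ≤ᵇ-reflects-≤ (+ 1) y) (lower-bound≤attained y∈N 1≤N) = refl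

-- The second alternative is the extra row (0 , + 0) below the diagram: f_a then creates a new string.
fStep-selects : ∀ N P Q ℓ c → c ℤ.≤ + 0 →
  All (λ s → rig s ≡ c ℤ.+ + 1) P → All (λ s → len s ℕ.≤ ℓ × c ℤ.≤ rig s) Q →
  (N ↭ P ++ (ℓ , c) ∷ Q) ⊎ (N ↭ P × Q ≡ [] × ℓ ≡ 0 × c ≡ + 0) →
  ∃[ rest ] fStep N ≡ ((suc ℓ , c ℤ.- + 1) , rest) × rest ↭ P ++ Q
          × (∀ i → minSum i N ≡ + (i ℕ.⊓ ℓ) ℤ.+ minSum i rest)
fStep-selects N P Q ℓ c c≤0 P≡c+1 Q≤ (inj₁ N↭) =
  removeOne (ℓ , c) N , step , rest↭ , λ i → minSum-↭ i N↭ℓ,c∷rest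
  where
  c<c+1 : c ℤ.< c ℤ.+ + 1
  c<c+1 = ℤP.suc[i]≤j⇒i<j (ℤP.≤-reflexive (ℤP.+-comm (+ 1) c))
  ℓ,c∈N : (ℓ , c) ∈ N
  ℓ,c∈N = ∈-resp-↭ (↭-sym N↭) (++⁺ʳ P (here refl))
  c≤N : All (λ s → c ℤ.≤ rig s) N
  c≤N = All-resp-↭ (↭-sym N↭)
          (AllP.++⁺ (All.map (λ eq → ℤP.≤-trans (ℤP.<⇒≤ c<c+1) (ℤP.≤-reflexive (sym eq))) P≡c+1)
                   (ℤP.≤-refl ∷ All.map proj₂ Q≤))
  c-strings-≤ℓ : All (λ s → rig s ≡ c → len s ℕ.≤ ℓ) N
  c-strings-≤ℓ = All-resp-↭ (↭-sym N↭)
          (AllP.++⁺ (All.map (λ eq eq' → contradiction (trans (sym eq') eq) (ℤP.<⇒≢ c<c+1)) P≡c+1)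
                   ((λ _ → ℕP.≤-refl) ∷ All.map (λ q _ → proj₁ q) Q≤))
  maxLen≡ℓ : maxLenWithLabel c N ≡ ℓ
  maxLen≡ℓ = ℕP.≤-antisym (maxLenWithLabel-≤ c ℓ N c-strings-≤ℓ) (≤-maxLenWithLabel c ℓ N ℓ,c∈N)
  step : fStep N ≡ ((suc ℓ , c ℤ.- + 1) , removeOne (ℓ , c) N)
  step = subst (λ l → fStep N ≡ ((suc l , c ℤ.- + 1) , removeOne (l , c) N)) maxLen≡ℓ
           (fStep-nonpositive N (minLabel-attained N (Any-resp-↭ (↭-sym N↭) (++⁺ʳ P (here refl))) c≤N) c≤0)
  N↭ℓ,c∷rest : N ↭ (ℓ , c) ∷ removeOne (ℓ , c) N
  N↭ℓ,c∷rest = removeOne-↭ (ℓ , c) N ℓ,c∈N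
  rest↭ : removeOne (ℓ , c) N ↭ P ++ Q
  rest↭ = drop-∷ (↭-trans (↭-sym N↭ℓ,c∷rest) (↭-trans N↭ (shift (ℓ , c) P Q)))
fStep-selects N P Q ℓ c c≤0 P≡1 Q≤ (inj₂ (N↭P , refl , refl , refl)) =
  N , fStep-positive N (All-resp-↭ (↭-sym N↭P) (All.map (ℤP.≤-reflexive ∘ sym) P≡1)) ,
  ↭-trans N↭P (↭-reflexive (sym (LP.++-identityʳ P))) , minSums
  where
  minSums : ∀ i → minSum i N ≡ + (i ℕ.⊓ 0) ℤ.+ minSum i N
  minSums i = sym (trans (cong (λ k → + k ℤ.+ minSum i N) (ℕP.⊓-zeroʳ i)) (ℤP.+-identityˡ _))

-- Vacancy numbers and the effect of f_a

sumℤ-applyUpTo-update : ∀ {g g' : ℕ → ℤ} f k {j X} → j ℕ.< k →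
  (∀ i → i ≢ j → g' (f i) ≡ g (f i)) → g' (f j) ≡ g (f j) ℤ.+ X →
  sumℤ (map g' (applyUpTo f k)) ≡ sumℤ (map g (applyUpTo f k)) ℤ.+ X
sumℤ-applyUpTo-update {g} f (suc k) {zero} {X} _ same changed =
  trans (cong₂ ℤ._+_ changed (cong sumℤ (LP.map-cong-local (AllP.applyUpTo⁺₂ (f ∘ suc) k (λ i → same (suc i) λ ())))))
        (xy∙z≈xz∙y (g (f 0)) X _)
sumℤ-applyUpTo-update {g} f (suc k) {suc j} {X} (s≤s j<k) same changed =
  trans (cong₂ ℤ._+_ (same 0 λ ())
                     (sumℤ-applyUpTo-update (f ∘ suc) k j<k (λ i i≢j → same (suc i) (i≢j ∘ ℕP.suc-injective)) changed))
        (sym (ℤP.+-assoc (g (f 0)) _ X))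

vac-update : ∀ n C C' c b i δ → 1 ℕ.≤ c → c ℕ.≤ n →
  (∀ d → d ≢ c → minSum i (C' d) ≡ minSum i (C d)) → minSum i (C' c) ≡ minSum i (C c) ℤ.+ δ →
  vac n C' b i ≡ vac n C b i ℤ.- cartan b c ℤ.* δ
vac-update n C C' (suc j) b i δ _ j<n same changed =
  trans (cong ℤ.-_ (sumℤ-applyUpTo-update {g = g} {g' = g'} suc n j<n same′ changed′))
        (ℤP.neg-distrib-+ (sumℤ (map g (applyUpTo suc n))) _)
  where
  g g' : ℕ → ℤ
  g d = cartan b d ℤ.* minSum i (C d)
  g' d = cartan b d ℤ.* minSum i (C' d)
  same′ : ∀ d → d ≢ j → g' (suc d) ≡ g (suc d)
  same′ d d≢j = cong (cartan b (suc d) ℤ.*_) (same (suc d) (d≢j ∘ ℕP.suc-injective))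
  changed′ : g' (suc j) ≡ g (suc j) ℤ.+ cartan b (suc j) ℤ.* δ
  changed′ = trans (cong (cartan b (suc j) ℤ.*_) changed) (ℤP.*-distribˡ-+ (cartan b (suc j)) _ δ)

⊓-suc : ∀ i ℓ → i ℕ.⊓ suc ℓ ≡ i ℕ.⊓ ℓ ℕ.+ (if ℓ <ᵇ i then 1 else 0)
⊓-suc zero ℓ = refl
⊓-suc (suc i) zero = cong suc (ℕP.⊓-zeroʳ i)
⊓-suc (suc i) (suc ℓ) = cong suc (⊓-suc i ℓ)

subAbove : ℤ → ℕ → String → String
subAbove k ℓ s = if ℓ <ᵇ len s then (len s , rig s ℤ.- k) else s

-- Subtracting -[1+ 0 ] unfolds to adding + 1, so raiseAbove is definitionally the update of
-- colour m + 1 in the theorem.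
raiseAbove : ℕ → String → String
raiseAbove = subAbove -[1+ 0 ]

lowerAbove : ℕ → String → String
lowerAbove = subAbove (+ 1)

growLowered : String → String
growLowered s = suc (len s) , rig s ℤ.- + 1

clearRigging : String → String
clearRigging s = len s , + 0

-1+1≡id : ∀ x → x ℤ.- + 1 ℤ.+ + 1 ≡ x
-1+1≡id = solve-∀

subAbove-short : ∀ k ℓ s → len s ℕ.≤ ℓ → subAbove k ℓ s ≡ s
subAbove-short k ℓ s s≤ℓ rewrite reflects-false (ℕP.<ᵇ-reflects-< ℓ (len s)) (ℕP.≤⇒≯ s≤ℓ) = refl

subAbove-long : ∀ k ℓ s → ℓ ℕ.< len s → subAbove k ℓ s ≡ (len s , rig s ℤ.- k)
subAbove-long k ℓ s ℓ<s rewrite reflects-true (ℕP.<ᵇ-reflects-< ℓ (len s)) ℓ<s = refl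

len-subAbove : ∀ k ℓ s → len (subAbove k ℓ s) ≡ len s
len-subAbove k ℓ s with ℓ <ᵇ len s
... | true  = refl
... | false = refl

subAbove-zero : ∀ ℓ s → subAbove (+ 0) ℓ s ≡ s
subAbove-zero ℓ s with ℓ <ᵇ len s
... | true  = cong (len s ,_) (ℤP.+-identityʳ (rig s))
... | false = refl

clearRigging-id : ∀ {s} → rig s ≡ + 0 → clearRigging s ≡ s
clearRigging-id {s} rig≡0 = cong (len s ,_) (sym rig≡0)

raise-then-lower : ∀ t ℓ' s → ℓ' ℕ.≤ t → t ℕ.< len s → subAbove (+ 2) ℓ' (raiseAbove t s) ≡ lowerAbove ℓ' s
raise-then-lower t ℓ' s ℓ'≤t t<s =
  begin
    subAbove (+ 2) ℓ' (raiseAbove t s)     ≡⟨ cong (subAbove (+ 2) ℓ') (subAbove-long -[1+ 0 ] t s t<s) ⟩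
    subAbove (+ 2) ℓ' (len s , rig s ℤ.+ + 1) ≡⟨ subAbove-long (+ 2) ℓ' _ ℓ'<s ⟩
    (len s , rig s ℤ.+ + 1 ℤ.- + 2)        ≡⟨ cong (len s ,_) (+1-2 (rig s)) ⟩
    (len s , rig s ℤ.- + 1)                ≡⟨ subAbove-long (+ 1) ℓ' s ℓ'<s ⟨
    lowerAbove ℓ' s                        ∎
  where
  open ≡-Reasoning
  ℓ'<s = ℕP.≤-<-trans ℓ'≤t t<s
  +1-2 : ∀ x → x ℤ.+ + 1 ℤ.- + 2 ≡ x ℤ.- + 1
  +1-2 = solve-∀

lower-then-raise : ∀ t ℓ' s → ℓ' ℕ.≤ t → t ℕ.< len s → raiseAbove ℓ' (lowerAbove t s) ≡ s
lower-then-raise t ℓ' s ℓ'≤t t<s =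
  trans (cong (raiseAbove ℓ') (subAbove-long (+ 1) t s t<s))
        (trans (subAbove-long -[1+ 0 ] ℓ' _ (ℕP.≤-<-trans ℓ'≤t t<s)) (cong (len s ,_) (-1+1≡id (rig s))))

cartan-suc-right : ∀ b → cartan b (suc b) ≡ -[1+ 0 ]
cartan-suc-right b
  rewrite reflects-false (≡ᵇ-reflects-≡ b (suc b)) (ℕP.<⇒≢ (ℕP.n<1+n b))
        | reflects-true (≡ᵇ-reflects-≡ b b) refl = refl

cartan-suc-left : ∀ c → cartan (suc c) c ≡ -[1+ 0 ]
cartan-suc-left c
  rewrite reflects-false (≡ᵇ-reflects-≡ (suc c) c) (ℕP.>⇒≢ (ℕP.n<1+n c))
        | reflects-true (≡ᵇ-reflects-≡ c c) refl
  with suc (suc c) ≡ᵇ c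
... | true  = refl
... | false = refl

far-apart⇒≢ : ∀ {b c} → suc b ℕ.< c ⊎ suc c ℕ.< b → b ≢ c × suc b ≢ c × suc c ≢ b
far-apart⇒≢ {b} (inj₁ sb<c) = let b<c = ℕP.<-trans (ℕP.n<1+n b) sb<c in
  ℕP.<⇒≢ b<c , ℕP.<⇒≢ sb<c , ℕP.>⇒≢ (ℕP.m<n⇒m<1+n b<c)
far-apart⇒≢ {c = c} (inj₂ sc<b) = let c<b = ℕP.<-trans (ℕP.n<1+n c) sc<b in
  ℕP.>⇒≢ c<b , ℕP.>⇒≢ (ℕP.m<n⇒m<1+n c<b) , ℕP.<⇒≢ sc<b

cartan-far : ∀ b c → suc b ℕ.< c ⊎ suc c ℕ.< b → cartan b c ≡ + 0
cartan-far b c far with far-apart⇒≢ far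
... | b≢c , sb≢c , sc≢b
  rewrite reflects-false (≡ᵇ-reflects-≡ b c) b≢c
        | reflects-false (≡ᵇ-reflects-≡ (suc b) c) sb≢c
        | reflects-false (≡ᵇ-reflects-≡ (suc c) b) sc≢b = refl

-- The hypothesis minSums says that, as far as vacancy numbers can tell, C c is rest plus one
-- string of length ℓ (a string of length 0 when f_c creates a new string).
module FAction (n c : ℕ) (C : Config) {ℓ y rest} (1≤c : 1 ℕ.≤ c) (c≤n : c ℕ.≤ n)
         (step : fStep (C c) ≡ ((suc ℓ , y) , rest))
         (minSums : ∀ i → minSum i (C c) ≡ + (i ℕ.⊓ ℓ) ℤ.+ minSum i rest) where

  private
    C' : Config
    C' d = if d ≡ᵇ c then (suc ℓ , y) ∷ rest else C d

    minSum-grown : ∀ i → minSum i (C' c) ≡ minSum i (C c) ℤ.+ + (if ℓ <ᵇ i then 1 else 0)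
    minSum-grown i rewrite reflects-true (≡ᵇ-reflects-≡ c c) refl | minSums i | ⊓-suc i ℓ =
      trans (cong (ℤ._+ minSum i rest) (ℤP.pos-+ (i ℕ.⊓ ℓ) _)) (xy∙z≈xz∙y (+ (i ℕ.⊓ ℓ)) _ (minSum i rest))

    minSum-same : ∀ i d → d ≢ c → minSum i (C' d) ≡ minSum i (C d)
    minSum-same i d d≢c rewrite reflects-false (≡ᵇ-reflects-≡ d c) d≢c = refl

    adjust≡subAbove : ∀ b s → (len s , rig s ℤ.+ (vac n C' b (len s) ℤ.- vac n C b (len s))) ≡ subAbove (cartan b c) ℓ s
    adjust≡subAbove b s
      rewrite vac-update n C C' c b (len s) _ 1≤c c≤n (minSum-same (len s)) (minSum-grown (len s))
      with ℓ <ᵇ len s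
    ... | true  = cong (len s ,_) (lemma (rig s) (vac n C b (len s)) (cartan b c))
      where
      lemma : ∀ r v k → r ℤ.+ ((v ℤ.- k ℤ.* + 1) ℤ.- v) ≡ r ℤ.- k
      lemma = solve-∀
    ... | false = cong (len s ,_) (lemma (rig s) (vac n C b (len s)) (cartan b c))
      where
      lemma : ∀ r v k → r ℤ.+ ((v ℤ.- k ℤ.* + 0) ℤ.- v) ≡ r
      lemma = solve-∀

  f-at : f n c C c ≡ (suc ℓ , y) ∷ map (subAbove (+ 2) ℓ) rest
  f-at rewrite step | reflects-true (≡ᵇ-reflects-≡ c c) refl =
    cong ((suc ℓ , y) ∷_) (trans (LP.map-cong (adjust≡subAbove c) rest) (cong (λ k → map (subAbove k ℓ) rest) cartan-diag))
    where
    cartan-diag : cartan c c ≡ + 2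
    cartan-diag rewrite reflects-true (≡ᵇ-reflects-≡ c c) refl = refl

  f-off : ∀ b → b ≢ c → f n c C b ≡ map (subAbove (cartan b c) ℓ) (C b)
  f-off b b≢c rewrite step =
    trans (if-false (reflects-false (≡ᵇ-reflects-≡ b c) b≢c)) (LP.map-cong (adjust≡subAbove b) (C b))

  f-far : ∀ b → suc b ℕ.< c ⊎ suc c ℕ.< b → f n c C b ≡ C b
  f-far b apart = begin
    f n c C b                              ≡⟨ f-off b (proj₁ (far-apart⇒≢ apart)) ⟩
    map (subAbove (cartan b c) ℓ) (C b)    ≡⟨ cong (λ k → map (subAbove k ℓ) (C b)) (cartan-far b c apart) ⟩
    map (subAbove (+ 0) ℓ) (C b)           ≡⟨ trans (LP.map-cong (subAbove-zero ℓ) (C b)) (LP.map-id (C b)) ⟩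
    C b                                    ∎
    where open ≡-Reasoning

  f-below : ∀ b → suc b ≡ c → f n c C b ≡ map (raiseAbove ℓ) (C b)
  f-below b refl = trans (f-off b (ℕP.<⇒≢ (ℕP.n<1+n b))) (cong (λ k → map (subAbove k ℓ) (C b)) (cartan-suc-right b))

  f-above : ∀ b → b ≡ suc c → f n c C b ≡ map (raiseAbove ℓ) (C b)
  f-above b refl = trans (f-off b (ℕP.>⇒≢ (ℕP.n<1+n c))) (cong (λ k → map (subAbove k ℓ) (C b)) (cartan-suc-left c))

-- Interlacing and the invariant

Interlaced : RiggedPartition → RiggedPartition → Set
Interlaced ν ν' = (topDeleted (shape ν') ⊆ᴰ shape ν) × (shape ν ⊆ᴰ shape ν')

interlaced-resp-↭ : ∀ {ν₁ ν₁' ν₂ ν₂'} → ν₁ ↭ ν₂ → ν₁' ↭ ν₂' → Interlaced ν₁ ν₁' → Interlaced ν₂ ν₂'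
interlaced-resp-↭ p p' = subst₂ (λ ss ts → (topDeleted (map len ts) ⊆ᴰ map len ss) × (map len ss ⊆ᴰ map len ts))
                                (rows-cong p) (rows-cong p')

lengthAt-topDeleted : ∀ ν k → lengthAt (topDeleted (shape ν)) k ≡ lenAt (rows ν) (suc k)
lengthAt-topDeleted ν k with rows ν
... | [] = refl
... | s ∷ ss = lengthAt-map-len ss k

interlaced-rows : ∀ ν ν' →
  (∀ k → lenAt (rows ν') (suc k) ℕ.≤ lenAt (rows ν) k) → (∀ k → lenAt (rows ν) k ℕ.≤ lenAt (rows ν') k) →
  Interlaced ν ν'
interlaced-rows ν ν' below above =
  (λ k → subst₂ ℕ._≤_ (sym (lengthAt-topDeleted ν' k)) (sym (lengthAt-map-len (rows ν) k)) (below k)) ,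
  (λ k → subst₂ ℕ._≤_ (sym (lengthAt-map-len (rows ν) k)) (sym (lengthAt-map-len (rows ν') k)) (above k))

rows-interlaced : ∀ ν ν' → Interlaced ν ν' →
  (∀ k → lenAt (rows ν') (suc k) ℕ.≤ lenAt (rows ν) k) × (∀ k → lenAt (rows ν) k ℕ.≤ lenAt (rows ν') k)
rows-interlaced ν ν' (below , above) =
  (λ k → subst₂ ℕ._≤_ (lengthAt-topDeleted ν' k) (lengthAt-map-len (rows ν) k) (below k)) ,
  (λ k → subst₂ ℕ._≤_ (lengthAt-map-len (rows ν) k) (lengthAt-map-len (rows ν') k) (above k))

TopRiggingsMinimal : Config → ℕ → ℕ → Set
TopRiggingsMinimal C a m =
  (∀ i → i ℕ.< rIdx C a (m ∸ a) → rig (rowAt (rows (C m)) i) ≡ rig (rRow C a m))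
  × (rig (rRow C a m) ℤ.≤ + 0)
  × All (λ s → rig (rRow C a m) ℤ.≤ rig s) (C m)

record Invariant (C : Config) (k L : ℕ) : Set where
  field
    zeroRiggings : ∀ l → 1 ℕ.≤ l → l ℕ.< k → All (λ s → rig s ≡ + 0) (C l)
    interlaced : ∀ l → 1 ℕ.≤ l → l ℕ.< k → Interlaced (C l) (C (suc l))
    topRiggingsMinimal : ∀ a → 1 ℕ.≤ a → a ℕ.≤ k → suc k ∸ a ℕ.≤ L → TopRiggingsMinimal C a k

-- Applying one lower subinterval

module OneInterval (n : ℕ) (C : Config) (a m L : ℕ) (1≤a : 1 ℕ.≤ a) (a≤m : a ℕ.≤ m) (m≤n : m ℕ.≤ n)
                   (length≤L : suc m ∸ a ℕ.≤ L) (inv : Invariant C m L) where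

  open Invariant inv

  -- For d ≤ D = m - a: S d are the rows of μ_{a+d}, r d = r_{a+d} is row i d of S d, of length
  -- ℓ d and rigging c d, and P d, Q d are the rows above and below it.
  D : ℕ
  D = m ∸ a

  a+D≡m : a ℕ.+ D ≡ m
  a+D≡m = ℕP.m+[n∸m]≡n a≤m

  S : ℕ → List String
  S d = rows (C (a ℕ.+ d))

  i ℓ : ℕ → ℕ
  i d = rIdx C a d
  ℓ d = rLen C a d

  r : ℕ → String
  r d = rowAt (S d) (i d)

  c : ℕ → ℤ
  c d = rig (r d)

  P Q : ℕ → List String
  P d = take (i d) (S d)
  Q d = drop (suc (i d)) (S d)

  S-suc : ∀ d → S (suc d) ≡ rows (C (suc (a ℕ.+ d)))
  S-suc d = cong (rows ∘ C) (ℕP.+-suc a d)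

  i≤length : ∀ d → i d ℕ.≤ length (S d)
  i≤length zero = z≤n
  i≤length (suc d) = idxLE-≤-length (ℓ d) (S (suc d))

  ℓ-antitone : ∀ d → ℓ (suc d) ℕ.≤ ℓ d
  ℓ-antitone d = lenAt-idxLE (ℓ d) (S (suc d))

  ℓ<lenAt-next : ∀ d k → k ℕ.< i (suc d) → ℓ d ℕ.< lenAt (S (suc d)) k
  ℓ<lenAt-next d = lenAt-above-idxLE (ℓ d) (S (suc d))

  ℓ<lenAt : ∀ d k → k ℕ.< i d → ℓ d ℕ.< lenAt (S d) k
  ℓ<lenAt (suc d) k k<i = ℕP.≤-<-trans (ℓ-antitone d) (ℓ<lenAt-next d k k<i)

  lenAt≤ℓ : ∀ d k → i d ℕ.≤ k → lenAt (S d) k ℕ.≤ ℓ d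
  lenAt≤ℓ d k = lenAt-antitone (rows-sorted (C (a ℕ.+ d)))

  inside : ∀ d → d ℕ.< D → 1 ℕ.≤ a ℕ.+ d × a ℕ.+ d ℕ.< m
  inside d d<D = ℕP.≤-trans 1≤a (ℕP.m≤m+n a d) , subst (a ℕ.+ d ℕ.<_) a+D≡m (ℕP.+-monoʳ-< a d<D)

  interlacedInside : ∀ d → d ℕ.< D →
    (∀ k → lenAt (S (suc d)) (suc k) ℕ.≤ lenAt (S d) k) × (∀ k → lenAt (S d) k ℕ.≤ lenAt (S (suc d)) k)
  interlacedInside d d<D rewrite S-suc d =
    rows-interlaced (C (a ℕ.+ d)) (C (suc (a ℕ.+ d))) (uncurry (interlaced (a ℕ.+ d)) (inside d d<D))

  i-step : ∀ d → d ℕ.< D → i d ℕ.≤ i (suc d) × i (suc d) ℕ.≤ suc (i d)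
  i-step d d<D =
    idxLE-≥ (ℓ d) (S (suc d)) (i d) (λ k k<i → ℕP.<-≤-trans (ℓ<lenAt d k k<i) (proj₂ (interlacedInside d d<D) k)) ,
    idxLE-≤ (ℓ d) (S (suc d)) (suc (i d)) (proj₁ (interlacedInside d d<D) (i d))

  lenAt≤ℓ-next : ∀ d → d ℕ.< D → ∀ k → i d ℕ.< k → lenAt (S d) k ℕ.≤ ℓ (suc d)
  lenAt≤ℓ-next d d<D k i<k = begin
    lenAt (S d) k              ≤⟨ lenAt-antitone (rows-sorted (C (a ℕ.+ d))) i<k ⟩
    lenAt (S d) (suc (i d))    ≤⟨ proj₂ (interlacedInside d d<D) (suc (i d)) ⟩
    lenAt (S (suc d)) (suc (i d)) ≤⟨ lenAt-antitone (rows-sorted (C (a ℕ.+ suc d))) (proj₂ (i-step d d<D)) ⟩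
    ℓ (suc d)                  ∎
    where open ℕP.≤-Reasoning

  zeroRiggingsInside : ∀ d → d ℕ.< D → All (λ s → rig s ≡ + 0) (S d)
  zeroRiggingsInside d d<D = All-resp-↭ (↭-sym (rows-↭ _)) (uncurry (zeroRiggings (a ℕ.+ d)) (inside d d<D))

  RiggingProfile : ℕ → Set
  RiggingProfile d = (∀ k → k ℕ.< i d → rig (rowAt (S d) k) ≡ c d) × (c d ℤ.≤ + 0) × All (λ s → c d ℤ.≤ rig s) (S d)

  riggingProfile : ∀ d → d ℕ.≤ D → RiggingProfile d
  riggingProfile d d≤D with ℕP.m≤n⇒m<n∨m≡n d≤D
  ... | inj₁ d<D = (λ k _ → trans (rig≡0 k) (sym (rig≡0 (i d)))) , ℤP.≤-reflexive (rig≡0 (i d)) ,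
                   All.map (λ s≡0 → ℤP.≤-reflexive (trans (rig≡0 (i d)) (sym s≡0))) (zeroRiggingsInside d d<D)
    where
    rig≡0 : ∀ k → rig (rowAt (S d) k) ≡ + 0
    rig≡0 = rowAt-All (zeroRiggingsInside d d<D) refl
  ... | inj₂ refl = atEnd (topRiggingsMinimal a 1≤a a≤m length≤L)
    where
    atEnd : TopRiggingsMinimal C a m → RiggingProfile D
    atEnd top rewrite a+D≡m with top
    ... | equal , nonpositive , minimal = equal , nonpositive , All-resp-↭ (↭-sym (rows-↭ (C m))) minimal

  c≤0 : ∀ d → d ℕ.≤ D → c d ℤ.≤ + 0
  c≤0 d d≤D = proj₁ (proj₂ (riggingProfile d d≤D))

  c≡0 : ∀ d → d ℕ.< D → c d ≡ + 0
  c≡0 d d<D = rowAt-All (zeroRiggingsInside d d<D) refl (i d)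

  P-long : ∀ d → All (λ s → ℓ d ℕ.< len s) (P d)
  P-long d = All-take-rowAt (i d) (S d) (ℓ<lenAt d)

  P-long-next : ∀ d → All (λ s → ℓ d ℕ.< len s) (P (suc d))
  P-long-next d = All-take-rowAt (i (suc d)) (S (suc d)) (ℓ<lenAt-next d)

  P-rig : ∀ d → d ℕ.≤ D → All (λ s → rig s ≡ c d) (P d)
  P-rig d d≤D = All-take-rowAt (i d) (S d) (proj₁ (riggingProfile d d≤D))

  P-zero : ∀ d → d ℕ.< D → All (λ s → rig s ≡ + 0) (P d)
  P-zero d d<D = AllP.take⁺ (i d) (zeroRiggingsInside d d<D)

  Q-short : ∀ d → All (λ s → len s ℕ.≤ ℓ d) (Q d)
  Q-short d = All-drop-rowAt (suc (i d)) (S d) (λ k i<k _ → lenAt≤ℓ d k (ℕP.<⇒≤ i<k))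

  Q-short-next : ∀ d → d ℕ.< D → All (λ s → len s ℕ.≤ ℓ (suc d)) (Q d)
  Q-short-next d d<D = All-drop-rowAt (suc (i d)) (S d) (λ k i<k _ → lenAt≤ℓ-next d d<D k i<k)

  Q-rig : ∀ d → d ℕ.≤ D → All (λ s → c d ℤ.≤ rig s) (Q d)
  Q-rig d d≤D = AllP.drop⁺ (suc (i d)) (proj₂ (proj₂ (riggingProfile d d≤D)))

  Q-zero : ∀ d → d ℕ.< D → All (λ s → rig s ≡ + 0) (Q d)
  Q-zero d d<D = AllP.drop⁺ (suc (i d)) (zeroRiggingsInside d d<D)

  P-length : ∀ d → length (P d) ≡ i d
  P-length d = length-take-≤ (i d) (S d) (i≤length d)

  rowSplit : ∀ d → (S d ≡ P d ++ r d ∷ Q d) ⊎ (S d ≡ P d × Q d ≡ [] × r d ≡ (0 , + 0))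
  rowSplit d with ℕP.m≤n⇒m<n∨m≡n (i≤length d)
  ... | inj₁ i<length = inj₁ (rowAt-split (S d) (i d) i<length)
  ... | inj₂ i≡length = inj₂ (sym (LP.take-all (i d) (S d) length≤i) ,
                             LP.drop-all (suc (i d)) (S d) (ℕP.m≤n⇒m≤1+n length≤i) ,
                             rowAt-beyond (S d) (i d) length≤i)
    where
    length≤i : length (S d) ℕ.≤ i d
    length≤i = ℕP.≤-reflexive (sym i≡length)

  grownRows settledRows : ℕ → List String
  grownRows d = adjustRow (i d) growLowered (map (lowerAbove (ℓ d)) (S d))
  settledRows d = map clearRigging (addBoxAt (i d) (S d))

  subAbove-Q : ∀ k d → map (subAbove k (ℓ d)) (Q d) ≡ Q d
  subAbove-Q k d = LP.map-id-local (All.map (subAbove-short k (ℓ d) _) (Q-short d))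

  grownRows-split : ∀ d → grownRows d ≡ map (lowerAbove (ℓ d)) (P d) ++ (suc (ℓ d) , c d ℤ.- + 1) ∷ Q d
  grownRows-split d =
    trans (adjustRow-split (i d) growLowered _ (subst (i d ℕ.≤_) (sym (LP.length-map _ (S d))) (i≤length d)))
          (cong₂ _++_ (LP.take-map (i d) (S d))
                      (cong₂ _∷_ (cong growLowered (trans (rowAt-map refl (S d) (i d)) (subAbove-short (+ 1) (ℓ d) (r d) ℕP.≤-refl)))
                                 (trans (LP.drop-map (suc (i d)) (S d)) (subAbove-Q (+ 1) d))))

  settledRows-split : ∀ d → settledRows d ≡ map clearRigging (P d) ++ (suc (ℓ d) , + 0) ∷ map clearRigging (Q d)
  settledRows-split d = trans (cong (map clearRigging) (adjustRow-split (i d) _ (S d) (i≤length d))) (LP.map-++ clearRigging (P d) _)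

  located : ∀ d t {N} → ℓ d ℕ.≤ t → N ↭ map (raiseAbove t) (S d) →
    (N ↭ map (raiseAbove t) (P d) ++ (ℓ d , c d) ∷ Q d) ⊎ (N ↭ map (raiseAbove t) (P d) × Q d ≡ [] × ℓ d ≡ 0 × c d ≡ + 0)
  located d t {N} ℓ≤t N↭ with rowSplit d
  ... | inj₁ split = inj₁ (subst (N ↭_) raised N↭)
    where
    raised : map (raiseAbove t) (S d) ≡ map (raiseAbove t) (P d) ++ (ℓ d , c d) ∷ Q d
    raised = trans (cong (map (raiseAbove t)) split)
             (trans (LP.map-++ (raiseAbove t) (P d) _)
               (cong₂ (λ x xs → map (raiseAbove t) (P d) ++ x ∷ xs) (subAbove-short -[1+ 0 ] t (r d) ℓ≤t)
                      (LP.map-id-local (All.map (λ s≤ℓ → subAbove-short -[1+ 0 ] t _ (ℕP.≤-trans s≤ℓ ℓ≤t)) (Q-short d)))))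
  ... | inj₂ (S≡P , Q≡[] , r≡0) =
    inj₂ (subst (λ ss → N ↭ map (raiseAbove t) ss) S≡P N↭ , Q≡[] , cong len r≡0 , cong rig r≡0)

  grown-↭ : ∀ d t {rest} → ℓ d ℕ.≤ t → All (λ s → t ℕ.< len s) (P d) → rest ↭ map (raiseAbove t) (P d) ++ Q d →
    (suc (ℓ d) , c d ℤ.- + 1) ∷ map (subAbove (+ 2) (ℓ d)) rest ↭ grownRows d
  grown-↭ d t {rest} ℓ≤t t<P rest↭ = begin
    new ∷ map (subAbove (+ 2) (ℓ d)) rest
      ↭⟨ prep new (map⁺ _ rest↭) ⟩
    new ∷ map (subAbove (+ 2) (ℓ d)) (map (raiseAbove t) (P d) ++ Q d)
      ≡⟨ cong (new ∷_) (trans (LP.map-++ _ (map (raiseAbove t) (P d)) (Q d)) (cong₂ _++_ lowered (subAbove-Q (+ 2) d))) ⟩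
    new ∷ map (lowerAbove (ℓ d)) (P d) ++ Q d
      ↭⟨ ↭-sym (shift new (map (lowerAbove (ℓ d)) (P d)) (Q d)) ⟩
    map (lowerAbove (ℓ d)) (P d) ++ new ∷ Q d
      ≡⟨ grownRows-split d ⟨
    grownRows d ∎
    where
    open PermutationReasoning
    new = (suc (ℓ d) , c d ℤ.- + 1)
    lowered : map (subAbove (+ 2) (ℓ d)) (map (raiseAbove t) (P d)) ≡ map (lowerAbove (ℓ d)) (P d)
    lowered = trans (sym (LP.map-∘ (P d))) (LP.map-cong-local (All.map (raise-then-lower t (ℓ d) _ ℓ≤t) t<P))

  fStep-picks-r : ∀ d t N → d ℕ.≤ D → N ↭ map (raiseAbove t) (S d) → All (λ s → t ℕ.< len s) (P d) → ℓ d ℕ.≤ t →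
    ∃[ rest ] fStep N ≡ ((suc (ℓ d) , c d ℤ.- + 1) , rest)
            × (∀ j → minSum j N ≡ + (j ℕ.⊓ ℓ d) ℤ.+ minSum j rest)
            × (suc (ℓ d) , c d ℤ.- + 1) ∷ map (subAbove (+ 2) (ℓ d)) rest ↭ grownRows d
  fStep-picks-r d t N d≤D N↭ t<P ℓ≤t
    with fStep-selects N (map (raiseAbove t) (P d)) (Q d) (ℓ d) (c d) (c≤0 d d≤D)
           (AllP.map⁺ (All.zipWith raisedRig (t<P , P-rig d d≤D))) (All.zip (Q-short d , Q-rig d d≤D)) (located d t ℓ≤t N↭)
    where
    raisedRig : ∀ {s} → t ℕ.< len s × rig s ≡ c d → rig (raiseAbove t s) ≡ c d ℤ.+ + 1
    raisedRig {s} (t<s , refl) = cong rig (subAbove-long -[1+ 0 ] t s t<s)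
  ... | rest , step , rest↭ , minSums = rest , step , minSums , grown-↭ d t ℓ≤t t<P rest↭

  raise-grownRows : ∀ d → d ℕ.< D → map (raiseAbove (ℓ (suc d))) (grownRows d) ≡ settledRows d
  raise-grownRows d d<D = begin
    map (raiseAbove (ℓ (suc d))) (grownRows d)
      ≡⟨ cong (map (raiseAbove (ℓ (suc d)))) (grownRows-split d) ⟩
    map (raiseAbove (ℓ (suc d))) (map (lowerAbove (ℓ d)) (P d) ++ (suc (ℓ d) , c d ℤ.- + 1) ∷ Q d)
      ≡⟨ LP.map-++ _ (map (lowerAbove (ℓ d)) (P d)) _ ⟩
    map (raiseAbove (ℓ (suc d))) (map (lowerAbove (ℓ d)) (P d))
      ++ raiseAbove (ℓ (suc d)) (suc (ℓ d) , c d ℤ.- + 1) ∷ map (raiseAbove (ℓ (suc d))) (Q d)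
      ≡⟨ cong₂ _++_ P-settles (cong₂ _∷_ new-settles Q-settles) ⟩
    map clearRigging (P d) ++ (suc (ℓ d) , + 0) ∷ map clearRigging (Q d)
      ≡⟨ settledRows-split d ⟨
    settledRows d ∎
    where
    open ≡-Reasoning
    P-settles : map (raiseAbove (ℓ (suc d))) (map (lowerAbove (ℓ d)) (P d)) ≡ map clearRigging (P d)
    P-settles = trans (sym (LP.map-∘ (P d)))
      (LP.map-cong-local (All.zipWith (λ (ℓ<s , rig≡0) → trans (lower-then-raise (ℓ d) _ _ (ℓ-antitone d) ℓ<s)
                                                             (sym (clearRigging-id rig≡0)))
                                      (P-long d , P-zero d d<D)))
    new-settles : raiseAbove (ℓ (suc d)) (suc (ℓ d) , c d ℤ.- + 1) ≡ (suc (ℓ d) , + 0)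
    new-settles = trans (subAbove-long -[1+ 0 ] _ _ (s≤s (ℓ-antitone d)))
                        (cong (suc (ℓ d) ,_) (trans (-1+1≡id (c d)) (c≡0 d d<D)))
    Q-settles : map (raiseAbove (ℓ (suc d))) (Q d) ≡ map clearRigging (Q d)
    Q-settles = LP.map-cong-local (All.zipWith (λ (s≤ℓ , rig≡0) → trans (subAbove-short -[1+ 0 ] _ _ s≤ℓ)
                                                                        (sym (clearRigging-id rig≡0)))
                                               (Q-short-next d d<D , Q-zero d d<D))

  -- V = f_{a+d} ⋯ f_a C: colours a … a+d-1 are final, colour a+d has just been acted on, and
  -- colour a+d+1 has only been raised by f_{a+d}.
  record StateAfter (d : ℕ) (V : Config) : Set where
    field
      lower   : ∀ j → 1 ℕ.≤ j → j ℕ.< a → V j ↭ C j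
      settled : ∀ e → e ℕ.< d → V (a ℕ.+ e) ↭ settledRows e
      current : V (a ℕ.+ d) ↭ grownRows d
      next    : a ℕ.+ d ℕ.< n → V (a ℕ.+ suc d) ↭ map (raiseAbove (ℓ d)) (C (a ℕ.+ suc d))
      higher  : ∀ j → a ℕ.+ suc d ℕ.< j → j ℕ.≤ n → V j ↭ C j

  colour≤n : ∀ d → d ℕ.≤ D → a ℕ.+ d ℕ.≤ n
  colour≤n d d≤D = ℕP.≤-trans (subst (a ℕ.+ d ℕ.≤_) a+D≡m (ℕP.+-monoʳ-≤ a d≤D)) m≤n

  incoming-zero : C (a ℕ.+ 0) ↭ map (raiseAbove (ℓ 0)) (S 0)
  incoming-zero = ↭-sym (↭-trans (↭-reflexive unraised) (rows-↭ (C (a ℕ.+ 0))))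
    where
    unraised : map (raiseAbove (ℓ 0)) (S 0) ≡ S 0
    unraised = LP.map-id-local (All.map (subAbove-short -[1+ 0 ] (ℓ 0) _)
                                        (All-resp-↭ (↭-sym (rows-↭ _)) (len≤top (C (a ℕ.+ 0)))))

  incoming-suc : ∀ d V → suc d ℕ.≤ D → StateAfter d V → V (a ℕ.+ suc d) ↭ map (raiseAbove (ℓ d)) (S (suc d))
  incoming-suc d V sd≤D st =
    ↭-trans (StateAfter.next st (subst (ℕ._≤ n) (ℕP.+-suc a d) (colour≤n (suc d) sd≤D))) (map⁺ _ (↭-sym (rows-↭ _)))

  stateAfter-zero : StateAfter 0 (f n (a ℕ.+ 0) C)
  stateAfter-zero with fStep-picks-r 0 (ℓ 0) (C (a ℕ.+ 0)) z≤n incoming-zero [] ℕP.≤-refl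
  ... | rest , step , minSums , grown = record
    { lower = lower ; settled = λ _ () ; current = ↭-trans (↭-reflexive f-at) grown ; next = next ; higher = higher }
    where
    a+0≡a : a ℕ.+ 0 ≡ a
    a+0≡a = ℕP.+-identityʳ a
    open FAction n (a ℕ.+ 0) C (subst (1 ℕ.≤_) (sym a+0≡a) 1≤a) (colour≤n 0 z≤n) step minSums
    lower : ∀ j → 1 ℕ.≤ j → j ℕ.< a → f n (a ℕ.+ 0) C j ↭ C j
    lower j 1≤j j<a with ℕP.m≤n⇒m<n∨m≡n j<a
    ... | inj₁ sj<a = ↭-reflexive (f-far j (inj₁ (subst (suc j ℕ.<_) (sym a+0≡a) sj<a)))
    ... | inj₂ sj≡a = ↭-reflexive (trans (f-below j (trans sj≡a (sym a+0≡a)))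
                                        (LP.map-id-local (All.map (λ s≤ → subAbove-short -[1+ 0 ] (ℓ 0) _ (ℕP.≤-trans s≤ top≤))
                                                                  (len≤top (C j)))))
      where
      top≤ : lenAt (rows (C j)) 0 ℕ.≤ ℓ 0
      top≤ = subst (λ k → lenAt (rows (C j)) 0 ℕ.≤ lenAt (rows (C k)) 0) (trans sj≡a (sym a+0≡a))
               (proj₂ (rows-interlaced (C j) (C (suc j)) (interlaced j 1≤j (ℕP.<-≤-trans j<a a≤m))) 0)
    next : a ℕ.+ 0 ℕ.< n → f n (a ℕ.+ 0) C (a ℕ.+ 1) ↭ map (raiseAbove (ℓ 0)) (C (a ℕ.+ 1))
    next _ = ↭-reflexive (f-above (a ℕ.+ 1) (ℕP.+-suc a 0))
    higher : ∀ j → a ℕ.+ 1 ℕ.< j → j ℕ.≤ n → f n (a ℕ.+ 0) C j ↭ C j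
    higher j a+1<j _ = ↭-reflexive (f-far j (inj₂ (subst (ℕ._< j) (ℕP.+-suc a 0) a+1<j)))

  stateAfter-suc : ∀ d V → suc d ℕ.≤ D → StateAfter d V → StateAfter (suc d) (f n (a ℕ.+ suc d) V)
  stateAfter-suc d V sd≤D st
    with fStep-picks-r (suc d) (ℓ d) (V (a ℕ.+ suc d)) sd≤D (incoming-suc d V sd≤D st) (P-long-next d) (ℓ-antitone d)
  ... | rest , step , minSums , grown = record
    { lower = lower′ ; settled = settled′ ; current = ↭-trans (↭-reflexive f-at) grown ; next = next′ ; higher = higher′ }
    where
    open StateAfter st
    col = a ℕ.+ suc d
    col≡ : col ≡ suc (a ℕ.+ d)
    col≡ = ℕP.+-suc a d
    open FAction n col V (ℕP.≤-trans 1≤a (ℕP.m≤m+n a (suc d))) (colour≤n (suc d) sd≤D) step minSums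
    lower′ : ∀ j → 1 ℕ.≤ j → j ℕ.< a → f n col V j ↭ C j
    lower′ j 1≤j j<a =
      ↭-trans (↭-reflexive (f-far j (inj₁ (ℕP.<-≤-trans (s≤s j<a)
                                                       (subst (suc a ℕ.≤_) (sym col≡) (s≤s (ℕP.m≤m+n a d)))))))
              (lower j 1≤j j<a)
    settled′ : ∀ e → e ℕ.< suc d → f n col V (a ℕ.+ e) ↭ settledRows e
    settled′ e e<sd with ℕP.m≤n⇒m<n∨m≡n (ℕP.≤-pred e<sd)
    ... | inj₁ e<d =
      ↭-trans (↭-reflexive (f-far (a ℕ.+ e) (inj₁ (subst (ℕ._< col) (ℕP.+-suc a e) (ℕP.+-monoʳ-< a (s≤s e<d))))))
                             (settled e e<d)
    ... | inj₂ refl = ↭-trans (↭-reflexive (f-below (a ℕ.+ e) (sym col≡)))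
                              (↭-trans (map⁺ _ current) (↭-reflexive (raise-grownRows e sd≤D)))
    next′ : col ℕ.< n → f n col V (a ℕ.+ suc (suc d)) ↭ map (raiseAbove (ℓ (suc d))) (C (a ℕ.+ suc (suc d)))
    next′ col<n = ↭-trans (↭-reflexive (f-above _ (ℕP.+-suc a (suc d))))
                         (map⁺ _ (higher _ (ℕP.+-monoʳ-< a (ℕP.n<1+n (suc d))) (subst (ℕ._≤ n) (sym (ℕP.+-suc a (suc d))) col<n)))
    higher′ : ∀ j → a ℕ.+ suc (suc d) ℕ.< j → j ℕ.≤ n → f n col V j ↭ C j
    higher′ j a+ssd<j j≤n =
      ↭-trans (↭-reflexive (f-far j (inj₂ (subst (ℕ._< j) (ℕP.+-suc a (suc d)) a+ssd<j))))
              (higher j (ℕP.<-trans (ℕP.+-monoʳ-< a (ℕP.n<1+n (suc d))) a+ssd<j) j≤n)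

  configAfter : ℕ → Config
  configAfter d = applyFs n (applyUpTo (a ℕ.+_) (suc d)) C

  configAfter-suc : ∀ d → configAfter (suc d) ≡ f n (a ℕ.+ suc d) (configAfter d)
  configAfter-suc d =
    trans (cong (λ cs → applyFs n cs C) (sym (LP.applyUpTo-∷ʳ (a ℕ.+_) (suc d))))
          (LP.foldl-++ (λ V col → f n col V) C (applyUpTo (a ℕ.+_) (suc d)) (a ℕ.+ suc d ∷ []))

  stateAfter : ∀ d → d ℕ.≤ D → StateAfter d (configAfter d)
  stateAfter zero _ = stateAfter-zero
  stateAfter (suc d) sd≤D =
    subst (StateAfter (suc d)) (sym (configAfter-suc d)) (stateAfter-suc d _ sd≤D (stateAfter d (ℕP.<⇒≤ sd≤D)))

  μ' : Config
  μ' = applyFs n (intervalSeq (a , m)) C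

  final : StateAfter D μ'
  final = subst (StateAfter D) (cong (λ k → applyFs n (applyUpTo (a ℕ.+_) k) C) (sym (ℕP.+-∸-assoc 1 a≤m)))
                (stateAfter D ℕP.≤-refl)

  open StateAfter final

  settledRows-sorted : ∀ e → Sorted (settledRows e)
  settledRows-sorted e rewrite settledRows-split e =
    sorted-++-∷ (AllPairsP.map⁺ (AllPairs.map cleared (AllPairsP.take⁺ (i e) (rows-sorted (C (a ℕ.+ e))))))
                (AllP.map⁺ (All.map (λ ℓ<s → ≼-by-length ℓ<s ℤP.≤-refl) (P-long e)))
                (AllP.map⁺ (All.map (λ s≤ℓ → inj₁ (s≤s s≤ℓ)) (Q-short e)))
                (AllPairsP.map⁺ (AllPairs.map cleared (AllPairsP.drop⁺ (suc (i e)) (rows-sorted (C (a ℕ.+ e))))))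
    where
    cleared : ∀ {s t} → s ≼ t → clearRigging s ≼ clearRigging t
    cleared s≼t = ≼-by-length (≼⇒len-≥ s≼t) ℤP.≤-refl

  grownRows-sorted : Sorted (grownRows D)
  grownRows-sorted = subst Sorted (sym (trans (grownRows-split D) (cong (_++ (suc (ℓ D) , c D ℤ.- + 1) ∷ Q D) P-lowered))) (
    sorted-++-∷ (AllPairsP.map⁺ (AllPairs.map lowered (AllPairsP.take⁺ (i D) (rows-sorted (C (a ℕ.+ D))))))
                (AllP.map⁺ (All.zipWith (λ (ℓ<s , rig≡c) → ≼-by-length ℓ<s (ℤP.≤-reflexive (cong (ℤ._- + 1) rig≡c)))
                                        (P-long D , P-rig D ℕP.≤-refl)))
                (All.map (λ s≤ℓ → inj₁ (s≤s s≤ℓ)) (Q-short D))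
                (AllPairsP.drop⁺ (suc (i D)) (rows-sorted (C (a ℕ.+ D)))))
    where
    P-lowered : map (lowerAbove (ℓ D)) (P D) ≡ map (λ s → len s , rig s ℤ.- + 1) (P D)
    P-lowered = LP.map-cong-local (All.map (subAbove-long (+ 1) (ℓ D) _) (P-long D))
    lowered : ∀ {s t} → s ≼ t → (len s , rig s ℤ.- + 1) ≼ (len t , rig t ℤ.- + 1)
    lowered (inj₁ t<s) = inj₁ t<s
    lowered (inj₂ (s≡t , x≤y)) = inj₂ (s≡t , ℤP.+-monoˡ-≤ (ℤ.- + 1) x≤y)

  rows-settled : ∀ e → e ℕ.< D → rows (μ' (a ℕ.+ e)) ≡ settledRows e
  rows-settled e e<D = rows-of-sorted (settled e e<D) (settledRows-sorted e)

  rows-grown : rows (μ' (a ℕ.+ D)) ≡ grownRows D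
  rows-grown = rows-of-sorted current grownRows-sorted

  a+[j∸a]≡j : ∀ {j} → a ℕ.≤ j → a ℕ.+ (j ∸ a) ≡ j
  a+[j∸a]≡j = ℕP.m+[n∸m]≡n

  j∸a<D : ∀ {j} → a ℕ.≤ j → j ℕ.< m → j ∸ a ℕ.< D
  j∸a<D a≤j j<m = ℕP.∸-monoˡ-< j<m a≤j

  unchanged : ∀ j → 1 ℕ.≤ j → j ℕ.≤ n → (j ℕ.< a ⊎ suc m ℕ.< j) → μ' j ↭ C j
  unchanged j 1≤j j≤n (inj₁ j<a) = lower j 1≤j j<a
  unchanged j 1≤j j≤n (inj₂ sm<j) = higher j (subst (ℕ._< j) (sym (trans (ℕP.+-suc a D) (cong suc a+D≡m))) sm<j) j≤n

  shape-after : ∀ e → e ℕ.≤ D → shape (μ' (a ℕ.+ e)) ≡ map len (addBoxAt (i e) (S e))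
  shape-after e e≤D with ℕP.m≤n⇒m<n∨m≡n e≤D
  ... | inj₁ e<D rewrite rows-settled e e<D = sym (LP.map-∘ (addBoxAt (i e) (S e)))
  ... | inj₂ refl rewrite rows-grown =
    map-len-adjustRow (i D) (λ _ _ → cong suc) (trans (sym (LP.map-∘ (S D))) (LP.map-cong (len-subAbove (+ 1) (ℓ D)) (S D)))

  shape-at : ∀ j → a ℕ.≤ j → j ℕ.≤ m → shape (μ' j) ≡ map len (addBoxAt (rIdx C a (j ∸ a)) (rows (C j)))
  shape-at j a≤j j≤m = subst (λ k → shape (μ' k) ≡ map len (addBoxAt (i (j ∸ a)) (rows (C k)))) (a+[j∸a]≡j a≤j)
                             (shape-after (j ∸ a) (ℕP.∸-monoˡ-≤ a j≤m))

  zeroRiggings-at : ∀ j → a ℕ.≤ j → j ℕ.< m → All (λ s → rig s ≡ + 0) (μ' j)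
  zeroRiggings-at j a≤j j<m = subst (λ k → All (λ s → rig s ≡ + 0) (μ' k)) (a+[j∸a]≡j a≤j)
    (All-resp-↭ (↭-sym (settled (j ∸ a) (j∸a<D a≤j j<m))) (AllP.map⁺ (All.universal (λ _ → refl) _)))

  colour-m : μ' m ↭ adjustRow (i D) growLowered (map (lowerAbove (len (rowAt (rows (C m)) (i D)))) (rows (C m)))
  colour-m = subst (λ k → μ' k ↭ adjustRow (i D) growLowered (map (lowerAbove (len (rowAt (rows (C k)) (i D)))) (rows (C k))))
               a+D≡m current

  colour-suc-m : m ℕ.< n → μ' (suc m) ↭ map (raiseAbove (len (rowAt (rows (C m)) (i D)))) (C (suc m))
  colour-suc-m m<n = subst (λ k → μ' (suc k) ↭ map (raiseAbove (len (rowAt (rows (C k)) (i D)))) (C (suc k))) a+D≡m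
                       (subst (λ k → μ' k ↭ map (raiseAbove (ℓ D)) (C k)) (ℕP.+-suc a D) (next (subst (ℕ._< n) (sym a+D≡m) m<n)))

  lenAfter : ℕ → ℕ → ℕ
  lenAfter e = lenAt (rows (μ' (a ℕ.+ e)))

  lenAfter-addBox : ∀ e → e ℕ.≤ D → ∀ k → lenAfter e k ≡ lenAt (addBoxAt (i e) (S e)) k
  lenAfter-addBox e e≤D k =
    trans (sym (lengthAt-map-len (rows (μ' (a ℕ.+ e))) k))
          (trans (cong (λ ls → lengthAt ls k) (shape-after e e≤D)) (lengthAt-map-len (addBoxAt (i e) (S e)) k))

  lenAfter-grown : ∀ e → e ℕ.≤ D → lenAfter e (i e) ≡ suc (ℓ e)
  lenAfter-grown e e≤D = trans (lenAfter-addBox e e≤D (i e))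
    (trans (lenAt-adjustRow (i e) _ (S e) (i e) (i≤length e)) (if-true (reflects-true (≡ᵇ-reflects-≡ (i e) (i e)) refl)))

  lenAfter-other : ∀ e → e ℕ.≤ D → ∀ k → k ≢ i e → lenAfter e k ≡ lenAt (S e) k
  lenAfter-other e e≤D k k≢i = trans (lenAfter-addBox e e≤D k)
    (trans (lenAt-adjustRow (i e) _ (S e) k (i≤length e)) (if-false (reflects-false (≡ᵇ-reflects-≡ k (i e)) k≢i)))

  lenAfter-≥ : ∀ e → e ℕ.≤ D → ∀ k → lenAt (S e) k ℕ.≤ lenAfter e k
  lenAfter-≥ e e≤D k with k ℕP.≟ i e
  ... | yes refl = subst (lenAt (S e) (i e) ℕ.≤_) (sym (lenAfter-grown e e≤D)) (ℕP.n≤1+n _)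
  ... | no k≢i = ℕP.≤-reflexive (sym (lenAfter-other e e≤D k k≢i))

  interlacedAfter-below : ∀ e → e ℕ.< D → ∀ k → lenAfter (suc e) (suc k) ℕ.≤ lenAfter e k
  interlacedAfter-below e e<D k with suc k ℕP.≟ i (suc e)
  ... | no sk≢i = begin
    lenAfter (suc e) (suc k)     ≡⟨ lenAfter-other (suc e) e<D (suc k) sk≢i ⟩
    lenAt (S (suc e)) (suc k)    ≤⟨ proj₁ (interlacedInside e e<D) k ⟩
    lenAt (S e) k                ≤⟨ lenAfter-≥ e (ℕP.<⇒≤ e<D) k ⟩
    lenAfter e k                 ∎
    where open ℕP.≤-Reasoning
  ... | yes sk≡i with k ℕP.≟ i e
  ...   | yes refl = begin
    lenAfter (suc e) (suc k)     ≡⟨ cong (lenAfter (suc e)) sk≡i ⟩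
    lenAfter (suc e) (i (suc e)) ≡⟨ lenAfter-grown (suc e) e<D ⟩
    suc (ℓ (suc e))              ≤⟨ s≤s (ℓ-antitone e) ⟩
    suc (ℓ e)                    ≡⟨ lenAfter-grown e (ℕP.<⇒≤ e<D) ⟨
    lenAfter e k                 ∎
    where open ℕP.≤-Reasoning
  ...   | no k≢i = begin
    lenAfter (suc e) (suc k)     ≡⟨ cong (lenAfter (suc e)) sk≡i ⟩
    lenAfter (suc e) (i (suc e)) ≡⟨ lenAfter-grown (suc e) e<D ⟩
    suc (ℓ (suc e))              ≤⟨ s≤s (ℓ-antitone e) ⟩
    suc (ℓ e)                    ≤⟨ ℓ<lenAt e k k<i ⟩
    lenAt (S e) k                ≡⟨ lenAfter-other e (ℕP.<⇒≤ e<D) k k≢i ⟨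
    lenAfter e k                 ∎
    where
    open ℕP.≤-Reasoning
    k<i : k ℕ.< i e
    k<i = ℕP.≤∧≢⇒< (ℕP.≤-pred (subst (ℕ._≤ suc (i e)) (sym sk≡i) (proj₂ (i-step e e<D)))) k≢i

  interlacedAfter-above : ∀ e → e ℕ.< D → ∀ k → lenAfter e k ℕ.≤ lenAfter (suc e) k
  interlacedAfter-above e e<D k with k ℕP.≟ i e
  ... | no k≢i = begin
    lenAfter e k                 ≡⟨ lenAfter-other e (ℕP.<⇒≤ e<D) k k≢i ⟩
    lenAt (S e) k                ≤⟨ proj₂ (interlacedInside e e<D) k ⟩
    lenAt (S (suc e)) k          ≤⟨ lenAfter-≥ (suc e) e<D k ⟩
    lenAfter (suc e) k           ∎
    where open ℕP.≤-Reasoning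
  ... | yes refl with i e ℕP.≟ i (suc e)
  ...   | yes i≡i' = begin
    lenAfter e (i e)             ≡⟨ lenAfter-grown e (ℕP.<⇒≤ e<D) ⟩
    suc (ℓ e)                    ≤⟨ s≤s (subst (λ j → ℓ e ℕ.≤ lenAt (S (suc e)) j) i≡i'
                                               (proj₂ (interlacedInside e e<D) (i e))) ⟩
    suc (ℓ (suc e))              ≡⟨ lenAfter-grown (suc e) e<D ⟨
    lenAfter (suc e) (i (suc e)) ≡⟨ cong (lenAfter (suc e)) i≡i' ⟨
    lenAfter (suc e) (i e)       ∎
    where open ℕP.≤-Reasoning
  ...   | no i≢i' = begin
    lenAfter e (i e)             ≡⟨ lenAfter-grown e (ℕP.<⇒≤ e<D) ⟩
    suc (ℓ e)                    ≤⟨ ℓ<lenAt-next e (i e) (ℕP.≤∧≢⇒< (proj₁ (i-step e e<D)) i≢i') ⟩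
    lenAt (S (suc e)) (i e)      ≤⟨ lenAfter-≥ (suc e) e<D (i e) ⟩
    lenAfter (suc e) (i e)       ∎
    where open ℕP.≤-Reasoning

  interlaced′ : ∀ l → 1 ℕ.≤ l → l ℕ.< m → Interlaced (μ' l) (μ' (suc l))
  interlaced′ l 1≤l l<m with ℕP.<-≤-connex l a
  ... | inj₂ a≤l = subst₂ (λ x y → Interlaced (μ' x) (μ' y))
                          (a+[j∸a]≡j a≤l) (trans (ℕP.+-suc a (l ∸ a)) (cong suc (a+[j∸a]≡j a≤l)))
                          (interlaced-rows (μ' (a ℕ.+ (l ∸ a))) (μ' (a ℕ.+ suc (l ∸ a)))
                            (interlacedAfter-below (l ∸ a) (j∸a<D a≤l l<m)) (interlacedAfter-above (l ∸ a) (j∸a<D a≤l l<m)))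
  ... | inj₁ l<a with ℕP.m≤n⇒m<n∨m≡n l<a
  ...   | inj₁ sl<a = interlaced-resp-↭ (↭-sym (lower l 1≤l l<a)) (↭-sym (lower (suc l) (s≤s z≤n) sl<a))
                                           (interlaced l 1≤l l<m)
  ...   | inj₂ refl = interlaced-rows (μ' l) (μ' (suc l)) new-below new-above
    where
    old = rows-interlaced (C l) (C (suc l)) (interlaced l 1≤l l<m)
    sl≡sl+0 : suc l ≡ suc l ℕ.+ 0
    sl≡sl+0 = sym (ℕP.+-identityʳ (suc l))
    rows-l : rows (μ' l) ≡ rows (C l)
    rows-l = rows-cong (lower l 1≤l l<a)
    new-below : ∀ k → lenAt (rows (μ' (suc l))) (suc k) ℕ.≤ lenAt (rows (μ' l)) k
    new-below k = begin
      lenAt (rows (μ' (suc l))) (suc k)  ≡⟨ cong (λ x → lenAt (rows (μ' x)) (suc k)) sl≡sl+0 ⟩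
      lenAfter 0 (suc k)                 ≡⟨ lenAfter-other 0 z≤n (suc k) (λ ()) ⟩
      lenAt (S 0) (suc k)                ≡⟨ cong (λ x → lenAt (rows (C x)) (suc k)) sl≡sl+0 ⟨
      lenAt (rows (C (suc l))) (suc k)   ≤⟨ proj₁ old k ⟩
      lenAt (rows (C l)) k               ≡⟨ cong (λ ss → lenAt ss k) rows-l ⟨
      lenAt (rows (μ' l)) k              ∎
      where open ℕP.≤-Reasoning
    new-above : ∀ k → lenAt (rows (μ' l)) k ℕ.≤ lenAt (rows (μ' (suc l))) k
    new-above k = begin
      lenAt (rows (μ' l)) k              ≡⟨ cong (λ ss → lenAt ss k) rows-l ⟩
      lenAt (rows (C l)) k               ≤⟨ proj₂ old k ⟩
      lenAt (rows (C (suc l))) k         ≡⟨ cong (λ x → lenAt (rows (C x)) k) sl≡sl+0 ⟩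
      lenAt (S 0) k                      ≤⟨ lenAfter-≥ 0 z≤n k ⟩
      lenAfter 0 k                       ≡⟨ cong (λ x → lenAt (rows (μ' x)) k) sl≡sl+0 ⟨
      lenAt (rows (μ' (suc l))) k        ∎
      where open ℕP.≤-Reasoning

  P-lowered-rig : All (λ s → rig s ≡ c D ℤ.- + 1) (map (lowerAbove (ℓ D)) (P D))
  P-lowered-rig = AllP.map⁺ (All.zipWith (λ {s} (ℓ<s , rig≡c) → trans (cong rig (subAbove-long (+ 1) (ℓ D) s ℓ<s))
                                                                    (cong (ℤ._- + 1) rig≡c))
                                         (P-long D , P-rig D ℕP.≤-refl))

  grownRows-rig-top : ∀ k → k ℕ.≤ i D → rig (rowAt (grownRows D) k) ≡ c D ℤ.- + 1
  grownRows-rig-top k k≤i rewrite grownRows-split D with ℕP.m≤n⇒m<n∨m≡n k≤i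
  ... | inj₁ k<i = trans (cong rig (rowAt-++ˡ (map (lowerAbove (ℓ D)) (P D)) _ k k<length))
                         (All-rowAt P-lowered-rig k k<length)
    where
    k<length : k ℕ.< length (map (lowerAbove (ℓ D)) (P D))
    k<length = subst (k ℕ.<_) (sym (trans (LP.length-map _ (P D)) (P-length D))) k<i
  ... | inj₂ refl = cong rig (subst (λ j → rowAt (map (lowerAbove (ℓ D)) (P D) ++ new ∷ Q D) j ≡ new)
                                    (trans (LP.length-map _ (P D)) (P-length D))
                                    (rowAt-++-length (map (lowerAbove (ℓ D)) (P D)) new (Q D)))
    where
    new = (suc (ℓ D) , c D ℤ.- + 1)

  grownRows-rig-min : All (λ s → c D ℤ.- + 1 ℤ.≤ rig s) (grownRows D)
  grownRows-rig-min rewrite grownRows-split D =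
    AllP.++⁺ (All.map (ℤP.≤-reflexive ∘ sym) P-lowered-rig)
             (ℤP.≤-refl ∷ All.map (ℤP.≤-trans (ℤP.i-j≤i (c D) (+ 1))) (Q-rig D ℕP.≤-refl))

  grown-or-longer : ∀ e → e ℕ.≤ D → ∀ k → k ℕ.≤ i e → suc (ℓ e) ℕ.≤ lenAfter e k
  grown-or-longer e e≤D k k≤i with ℕP.m≤n⇒m<n∨m≡n k≤i
  ... | inj₁ k<i = ℕP.<-≤-trans (ℓ<lenAt e k k<i) (lenAfter-≥ e e≤D k)
  ... | inj₂ refl = ℕP.≤-reflexive (sym (lenAfter-grown e e≤D))

  rowsAfter-assoc : ∀ g d' → rows (μ' ((a ℕ.+ g) ℕ.+ d')) ≡ rows (μ' (a ℕ.+ (g ℕ.+ d')))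
  rowsAfter-assoc g d' = cong (rows ∘ μ') (ℕP.+-assoc a g d')

  rIdx-after : ∀ g d' → g ℕ.+ d' ℕ.≤ D →
    rIdx μ' (a ℕ.+ g) d' ℕ.≤ i (g ℕ.+ d') × suc (ℓ (g ℕ.+ d')) ℕ.≤ rLen μ' (a ℕ.+ g) d'
  rIdx-after g zero g≤D =
    z≤n , subst (λ ss → suc (ℓ (g ℕ.+ 0)) ℕ.≤ lenAt ss 0) (sym (rowsAfter-assoc g 0)) (grown-or-longer (g ℕ.+ 0) g≤D 0 z≤n)
  rIdx-after g (suc d') g+sd'≤D = idx≤ , grown≤
    where
    E = g ℕ.+ suc d'
    X = rows (μ' ((a ℕ.+ g) ℕ.+ suc d'))
    ih = rIdx-after g d' (ℕP.≤-trans (ℕP.+-monoʳ-≤ g (ℕP.n≤1+n d')) g+sd'≤D)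
    X-at-i : lenAt X (i E) ≡ suc (ℓ E)
    X-at-i = trans (cong (λ ss → lenAt ss (i E)) (rowsAfter-assoc g (suc d'))) (lenAfter-grown E g+sd'≤D)
    ℓE≤ : ℓ E ℕ.≤ ℓ (g ℕ.+ d')
    ℓE≤ = subst (λ j → ℓ j ℕ.≤ ℓ (g ℕ.+ d')) (sym (ℕP.+-suc g d')) (ℓ-antitone (g ℕ.+ d'))
    idx≤ : rIdx μ' (a ℕ.+ g) (suc d') ℕ.≤ i E
    idx≤ = idxLE-≤ (rLen μ' (a ℕ.+ g) d') X (i E)
             (subst (ℕ._≤ rLen μ' (a ℕ.+ g) d') (sym X-at-i) (ℕP.≤-trans (s≤s ℓE≤) (proj₂ ih)))
    grown≤ : suc (ℓ E) ℕ.≤ rLen μ' (a ℕ.+ g) (suc d')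
    grown≤ = subst (ℕ._≤ rLen μ' (a ℕ.+ g) (suc d')) X-at-i (lenAt-antitone (rows-sorted (μ' ((a ℕ.+ g) ℕ.+ suc d'))) idx≤)

  topRiggingsMinimal′ : ∀ a' → 1 ℕ.≤ a' → a' ℕ.≤ m → suc m ∸ a' ℕ.≤ suc m ∸ a → TopRiggingsMinimal μ' a' m
  topRiggingsMinimal′ a' _ a'≤m shorter = equal , nonpositive , minimal
    where
    a≤a' : a ℕ.≤ a'
    a≤a' = ℕP.≮⇒≥ (λ a'<a → ℕP.<⇒≱ (ℕP.∸-monoʳ-< a'<a (ℕP.m≤n⇒m≤1+n a≤m)) shorter)
    g = a' ∸ a
    g+d'≡D : g ℕ.+ (m ∸ a') ≡ D
    g+d'≡D = ℕP.+-cancelˡ-≡ a _ _ (begin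
      a ℕ.+ (g ℕ.+ (m ∸ a'))   ≡⟨ ℕP.+-assoc a g (m ∸ a') ⟨
      a ℕ.+ g ℕ.+ (m ∸ a')     ≡⟨ cong (ℕ._+ (m ∸ a')) (a+[j∸a]≡j a≤a') ⟩
      a' ℕ.+ (m ∸ a')          ≡⟨ ℕP.m+[n∸m]≡n a'≤m ⟩
      m                        ≡⟨ a+D≡m ⟨
      a ℕ.+ D                  ∎)
      where open ≡-Reasoning
    idx = rIdx μ' a' (m ∸ a')
    idx≤i : idx ℕ.≤ i D
    idx≤i = subst₂ (λ x y → rIdx μ' x (m ∸ a') ℕ.≤ i y) (a+[j∸a]≡j a≤a') g+d'≡D
                   (proj₁ (rIdx-after g (m ∸ a') (ℕP.≤-reflexive g+d'≡D)))
    rows-m : rows (μ' m) ≡ grownRows D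
    rows-m = subst (λ k → rows (μ' k) ≡ grownRows D) a+D≡m rows-grown
    rig-r : rig (rRow μ' a' m) ≡ c D ℤ.- + 1
    rig-r = trans (cong (λ ss → rig (rowAt ss idx)) rows-m) (grownRows-rig-top idx idx≤i)
    equal : ∀ k → k ℕ.< idx → rig (rowAt (rows (μ' m)) k) ≡ rig (rRow μ' a' m)
    equal k k<idx = trans (cong (λ ss → rig (rowAt ss k)) rows-m)
                          (trans (grownRows-rig-top k (ℕP.≤-trans (ℕP.<⇒≤ k<idx) idx≤i)) (sym rig-r))
    nonpositive : rig (rRow μ' a' m) ℤ.≤ + 0
    nonpositive = subst (ℤ._≤ + 0) (sym rig-r) (ℤP.≤-trans (ℤP.i-j≤i (c D) (+ 1)) (c≤0 D ℕP.≤-refl))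
    minimal : All (λ s → rig (rRow μ' a' m) ℤ.≤ rig s) (μ' m)
    minimal = subst (λ x → All (λ s → x ℤ.≤ rig s) (μ' m)) (sym rig-r)
                    (All-resp-↭ (↭-sym (subst (λ k → μ' k ↭ grownRows D) a+D≡m current)) grownRows-rig-min)

  invariantAfter : Invariant μ' m (suc m ∸ a)
  invariantAfter = record { zeroRiggings = zeroRiggings′ ; interlaced = interlaced′ ; topRiggingsMinimal = topRiggingsMinimal′ }
    where
    zeroRiggings′ : ∀ l → 1 ℕ.≤ l → l ℕ.< m → All (λ s → rig s ≡ + 0) (μ' l)
    zeroRiggings′ l 1≤l l<m with ℕP.<-≤-connex l a
    ... | inj₁ l<a = All-resp-↭ (↭-sym (lower l 1≤l l<a)) (zeroRiggings l 1≤l l<m)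
    ... | inj₂ a≤l = zeroRiggings-at l a≤l l<m

-- Cascading sequences

Follows : ℕ → Interval → ℕ → ℕ → Set
Follows n (a , m) K L = 1 ℕ.≤ a × a ℕ.≤ m × m ℕ.≤ n × (m ℕ.< K ⊎ (m ≡ K × suc m ∸ a ℕ.≤ L))

data Chain (n : ℕ) : ℕ → ℕ → List Interval → Set where
  []  : ∀ {K L} → Chain n K L []
  _∷_ : ∀ {K L a m Is} → Follows n (a , m) K L → Chain n m (suc m ∸ a) Is → Chain n K L ((a , m) ∷ Is)

HeadLength≤ : ℕ → List Interval → Set
HeadLength≤ L [] = ⊤
HeadLength≤ L (I ∷ _) = intervalLength I ℕ.≤ L

component-chain : ∀ {n k β} c → suc k ℕ.≤ n → IsComponent (suc k) c → (∀ {K L} → k ℕ.< K → Chain n K L β) →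
  ∀ {K L} → suc k ℕ.< K ⊎ (K ≡ suc k × HeadLength≤ L c) → Chain n K L (c ++ β)
component-chain [] _ _ β-chain (inj₁ sk<K) = β-chain (ℕP.<-trans (ℕP.n<1+n _) sk<K)
component-chain [] _ _ β-chain (inj₂ (refl , _)) = β-chain (ℕP.n<1+n _)
component-chain ((a , _) ∷ c) sk≤n ((refl , 1≤a , a≤sk) ∷ lowers , noninc) β-chain fits =
  (1≤a , a≤sk , sk≤n , map₂ (λ (K≡sk , length≤L) → sym K≡sk , length≤L) fits)
  ∷ component-chain c sk≤n (lowers , tail noninc) β-chain (inj₂ (refl , head noninc))
  where
  tail : ∀ {I Is} → NonincLen (I ∷ Is) → NonincLen Is
  tail [-] = []
  tail (_ ∷ ni) = ni
  head : ∀ {I Is} → NonincLen (I ∷ Is) → HeadLength≤ (intervalLength I) Is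
  head [-] = tt
  head (≤I ∷ _) = ≤I

cascading-chain : ∀ {n} k {α} → k ℕ.≤ n → IsCascading k α → ∀ {K L} → k ℕ.< K → Chain n K L α
cascading-chain zero _ refl _ = []
cascading-chain (suc k) sk≤n (c , β , component , cascading , refl) k<K =
  component-chain c sk≤n component (cascading-chain k (ℕP.<⇒≤ sk≤n) cascading) (inj₁ k<K)

invariant-empty : ∀ K L → Invariant emptyConfig K L
invariant-empty K L = record
  { zeroRiggings = λ _ _ _ → []
  ; interlaced = λ _ _ _ → (λ _ → z≤n) , (λ _ → z≤n)
  ; topRiggingsMinimal = λ _ _ _ _ → (λ _ _ → refl) , ℤP.≤-refl , [] }

invariant-restrict : ∀ {C K L m} → Invariant C K L → 1 ℕ.≤ m → m ℕ.< K → Invariant C m m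
invariant-restrict {C} {m = m} inv 1≤m m<K = record
  { zeroRiggings = λ l 1≤l l<m → zeroRiggings l 1≤l (ℕP.<-trans l<m m<K)
  ; interlaced = λ l 1≤l l<m → interlaced l 1≤l (ℕP.<-trans l<m m<K)
  ; topRiggingsMinimal = λ a' _ _ _ → allZero a'
  }
  where
  open Invariant inv
  rig≡0 : ∀ k → rig (rowAt (rows (C m)) k) ≡ + 0
  rig≡0 = rowAt-All (All-resp-↭ (↭-sym (rows-↭ (C m))) (zeroRiggings m 1≤m m<K)) refl
  allZero : ∀ a' → TopRiggingsMinimal C a' m
  allZero a' = (λ j _ → trans (rig≡0 j) (sym (rig≡0 k))) , ℤP.≤-reflexive (rig≡0 k) ,
               All.map (λ s≡0 → ℤP.≤-reflexive (trans (rig≡0 k) (sym s≡0))) (zeroRiggings m 1≤m m<K)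
    where
    k = rIdx C a' (m ∸ a')

invariant-enter : ∀ {n C K L a m} → Invariant C K L → Follows n (a , m) K L → ∃[ L' ] suc m ∸ a ℕ.≤ L' × Invariant C m L'
invariant-enter {m = m} inv (1≤a , a≤m , _ , inj₁ m<K) =
  m , ℕP.∸-monoʳ-≤ (suc m) 1≤a , invariant-restrict inv (ℕP.≤-trans 1≤a a≤m) m<K
invariant-enter {L = L} inv (_ , _ , _ , inj₂ (refl , length≤L)) = L , length≤L , inv

invariant-before : ∀ n C K L pre a m post → Invariant C K L → Chain n K L (pre ++ (a , m) ∷ post) →
  1 ℕ.≤ a × a ℕ.≤ m × m ℕ.≤ n × ∃[ L' ] suc m ∸ a ℕ.≤ L' × Invariant (applyFs n (toSeq pre) C) m L'
invariant-before n C K L [] a m post inv (follows@(1≤a , a≤m , m≤n , _) ∷ _) =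
  1≤a , a≤m , m≤n , invariant-enter inv follows
invariant-before n C K L ((a' , m') ∷ pre) a m post inv (follows@(1≤a' , a'≤m' , m'≤n , _) ∷ chain)
  with invariant-enter inv follows
... | L' , length≤L' , inv' =
  subst (λ V → 1 ℕ.≤ a × a ℕ.≤ m × m ℕ.≤ n × ∃[ L'' ] suc m ∸ a ℕ.≤ L'' × Invariant V m L'')
        (sym (LP.foldl-++ (λ V col → f n col V) C (intervalSeq (a' , m')) (toSeq pre)))
        (invariant-before n _ m' _ pre a m post
           (OneInterval.invariantAfter n C a' m' L' 1≤a' a'≤m' m'≤n length≤L' inv') chain)

mainTheorem4 :
  ∀ (n : ℕ) (pre : List Interval) (a m : ℕ) (post : List Interval) →
  IsCascading n (pre ++ (a , m) ∷ post) →
  let μ  = R n (toSeq pre)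
      μ' = applyFs n (intervalSeq (a , m)) μ
      rm = rRow μ a m
  in
  -- (1)
  (∀ l → 1 ℕ.≤ l → l ℕ.< m → All (λ s → rig s ≡ + 0) (μ l))
  × (∀ l → 1 ℕ.≤ l → l ℕ.< m →
       (topDeleted (shape (μ (suc l))) ⊆ᴰ shape (μ l))
       × (shape (μ l) ⊆ᴰ shape (μ (suc l))))
  -- (2)
  × (∀ i → i ℕ.< rIdx μ a (m ∸ a) → rig (rowAt (rows (μ m)) i) ≡ rig rm)
  × (rig rm ℤ.≤ + 0)
  × All (λ s → rig rm ℤ.≤ rig s) (μ m)
  -- (3)
  × (∀ j → 1 ℕ.≤ j → j ℕ.≤ n → (j ℕ.< a ⊎ suc m ℕ.< j) → μ' j ↭ μ j)
  × (∀ j → a ℕ.≤ j → j ℕ.≤ m →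
       shape (μ' j) ≡ map len (addBoxAt (rIdx μ a (j ∸ a)) (rows (μ j))))
  × (∀ j → a ℕ.≤ j → j ℕ.< m → All (λ s → rig s ≡ + 0) (μ' j))
  × (μ' m ↭ adjustRow (rIdx μ a (m ∸ a)) (λ s → suc (len s) , rig s ℤ.- + 1)
               (map (λ s → if len rm <ᵇ len s then (len s , rig s ℤ.- + 1) else s)
                    (rows (μ m))))
  × (m ℕ.< n →
       μ' (suc m) ↭ map (λ s → if len rm <ᵇ len s then (len s , rig s ℤ.+ + 1) else s)
                        (μ (suc m)))
mainTheorem4 n pre a m post cascading
  with invariant-before n emptyConfig (suc n) (suc n) pre a m post (invariant-empty (suc n) (suc n))
         (cascading-chain n ℕP.≤-refl cascading (ℕP.n<1+n n))
... | 1≤a , a≤m , m≤n , L , length≤L , inv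
  with Invariant.topRiggingsMinimal inv a 1≤a a≤m length≤L
... | equal , nonpositive , minimal =
  zeroRiggings , interlaced , equal , nonpositive , minimal ,
  unchanged , shape-at , zeroRiggings-at , colour-m , colour-suc-m
  where
  open Invariant inv
  open OneInterval n (R n (toSeq pre)) a m L 1≤a a≤m m≤n length≤L inv
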